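{- Any quantum algorithm that computes the longest square substring of a string of length $n$ (i.e. the maximum shift $\Delta$ such that $s[i..i+\Delta)=s[i+\Delta..i+2\Delta)$ for some $i\in[1..n-2\Delta+1]$) requires $\Omega(\sqrt n)$ queries.
   Context: Strings are 1-indexed sequences over an integer alphabet; $s[i..j)=s[i]\cdots s[j-1]$. Quantum query model: the input string $s$ is accessed through a unitary oracle $O_s:|i,b\rangle\mapsto|i,b\oplus s[i]\rangle$ ($\oplus$ is XOR of binary encodings of characters), which can be queried in superposition; between queries the algorithm may apply arbitrary unitaries independent of the input; it must output the correct answer with probability at least $2/3$. Query complexity is the number of oracle calls. -}

module Defs where

open import Algebra.Bundles.Raw using (RawRing)
import Algebra.Definitions.RawMonoid as RawMonoidOps
open import Data.Bool.Base using (if_then_else_)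
open import Data.Fin.Base as Fin using (Fin; zero; suc)
import Data.Fin.Properties as Fin
open import Data.Integer.Base using (+_)
open import Data.List.Base using (List; take; drop)
open import Data.Nat.Base as ℕ using (ℕ; suc)
import Data.Nat.Properties as ℕ
open import Data.Product.Base using (_×_; _,_; ∃; ∃-syntax)
open import Data.Product.Properties using (≡-dec)
open import Data.Rational.Base as ℚ using (ℚ; 0ℚ; 1ℚ; ½)
import Data.Rational.Properties as ℚ
open import Data.Rational.Solver using (module +-*-Solver)
open import Data.Vec.Base using (Vec; lookup; toList)
open import Data.Vec.Functional as Vector using (Vector)
open import Level using (0ℓ)
open import Relation.Binary.Definitions using (DecidableEquality)
open import Relation.Binary.PropositionalEquality
  using (_≡_; refl; sym; trans; cong; subst)
open import Relation.Nullary.Decidable using (⌊_⌋)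

-- Real numbers: Cauchy sequences of rationals, with pointwise operations.
-- Equality is the setoid equality _≈ʳ_ (the difference tends to 0).

Eventually : (ℕ → Set) → Set
Eventually P = ∃[ N ] (∀ n → N ℕ.≤ n → P n)

IsCauchy : (ℕ → ℚ) → Set
IsCauchy x = ∀ ε → 0ℚ ℚ.< ε →
  ∃[ N ] (∀ m n → N ℕ.≤ m → N ℕ.≤ n → ℚ.∣ x m ℚ.- x n ∣ ℚ.≤ ε)

record ℝ : Set where
  constructor mkℝ
  field
    seq    : ℕ → ℚ
    cauchy : IsCauchy seq

open ℝ public

private
  abstract
    half-pos : ∀ {ε} → 0ℚ ℚ.< ε → 0ℚ ℚ.< ½ ℚ.* ε
    half-pos {ε} ε>0 =
      subst (ℚ._< ½ ℚ.* ε) (ℚ.*-zeroʳ ½) (ℚ.*-monoʳ-<-pos ½ ε>0)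

    ½ε+½ε : ∀ ε → ½ ℚ.* ε ℚ.+ ½ ℚ.* ε ≡ ε
    ½ε+½ε ε = trans (sym (ℚ.*-distribʳ-+ ε ½ ½)) (ℚ.*-identityˡ ε)

    +-cauchy : ∀ {x y} → IsCauchy x → IsCauchy y →
               IsCauchy (λ n → x n ℚ.+ y n)
    +-cauchy {x} {y} cx cy ε ε>0
      with cx (½ ℚ.* ε) (half-pos ε>0) | cy (½ ℚ.* ε) (half-pos ε>0)
    ... | M , p | N , q = M ℕ.⊔ N , λ m n m≥ n≥ → begin
        ℚ.∣ (x m ℚ.+ y m) ℚ.- (x n ℚ.+ y n) ∣
          ≡⟨ cong ℚ.∣_∣ (regroup (x m) (y m) (x n) (y n)) ⟩
        ℚ.∣ (x m ℚ.- x n) ℚ.+ (y m ℚ.- y n) ∣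
          ≤⟨ ℚ.∣p+q∣≤∣p∣+∣q∣ (x m ℚ.- x n) (y m ℚ.- y n) ⟩
        ℚ.∣ x m ℚ.- x n ∣ ℚ.+ ℚ.∣ y m ℚ.- y n ∣
          ≤⟨ ℚ.+-mono-≤ (p m n (ℕ.m⊔n≤o⇒m≤o M N m≥) (ℕ.m⊔n≤o⇒m≤o M N n≥))
                        (q m n (ℕ.m⊔n≤o⇒n≤o M N m≥) (ℕ.m⊔n≤o⇒n≤o M N n≥)) ⟩
        ½ ℚ.* ε ℚ.+ ½ ℚ.* ε
          ≡⟨ ½ε+½ε ε ⟩
        ε ∎
      where
      open ℚ.≤-Reasoning
      open +-*-Solver
      regroup : ∀ a b c d →
        (a ℚ.+ b) ℚ.- (c ℚ.+ d) ≡ (a ℚ.- c) ℚ.+ (b ℚ.- d)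
      regroup = solve 4 (λ a b c d →
        (a :+ b) :- (c :+ d) := (a :- c) :+ (b :- d)) refl

    neg-cauchy : ∀ {x} → IsCauchy x → IsCauchy (λ n → ℚ.- x n)
    neg-cauchy {x} cx ε ε>0 with cx ε ε>0
    ... | N , p = N , λ m n m≥ n≥ → subst (ℚ._≤ ε)
        (trans (sym (ℚ.∣-p∣≡∣p∣ (x m ℚ.- x n)))
               (cong ℚ.∣_∣ (ℚ.neg-distrib-+ (x m) (ℚ.- x n))))
        (p m n m≥ n≥)

    0<1 : 0ℚ ℚ.< 1ℚ
    0<1 = ℚ.positive⁻¹ 1ℚ

    bounded : ∀ {x} → IsCauchy x →
              ∃[ B ] (0ℚ ℚ.< B × Eventually (λ n → ℚ.∣ x n ∣ ℚ.≤ B))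
    bounded {x} cx with cx 1ℚ 0<1
    ... | N , p =
        1ℚ ℚ.+ ℚ.∣ x N ∣
      , ℚ.+-mono-<-≤ 0<1 (ℚ.0≤∣p∣ (x N))
      , N , λ n n≥ → begin
        ℚ.∣ x n ∣
          ≡⟨ cong ℚ.∣_∣ (regroup (x n) (x N)) ⟩
        ℚ.∣ (x n ℚ.- x N) ℚ.+ x N ∣
          ≤⟨ ℚ.∣p+q∣≤∣p∣+∣q∣ (x n ℚ.- x N) (x N) ⟩
        ℚ.∣ x n ℚ.- x N ∣ ℚ.+ ℚ.∣ x N ∣
          ≤⟨ ℚ.+-monoˡ-≤ ℚ.∣ x N ∣ (p n N n≥ ℕ.≤-refl) ⟩
        1ℚ ℚ.+ ℚ.∣ x N ∣ ∎
      where
      open ℚ.≤-Reasoning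
      open +-*-Solver
      regroup : ∀ a b → a ≡ (a ℚ.- b) ℚ.+ b
      regroup = solve 2 (λ a b → a := (a :- b) :+ b) refl

    shrink : ∀ {B ε} → 0ℚ ℚ.< B → 0ℚ ℚ.< ε →
             ∃[ δ ] (0ℚ ℚ.< δ × δ ℚ.* B ≡ ε)
    shrink {B} {ε} B>0 ε>0 = ε ℚ.* B⁻¹ , δ>0 , δB≡ε
      where
      instance
        B-pos : ℚ.Positive B
        B-pos = ℚ.positive B>0
        B-nonZero : ℚ.NonZero B
        B-nonZero = ℚ.pos⇒nonZero B
      B⁻¹ : ℚ
      B⁻¹ = ℚ.1/ B
      instance
        B⁻¹-pos : ℚ.Positive B⁻¹
        B⁻¹-pos = ℚ.1/pos⇒pos B
      δ>0 : 0ℚ ℚ.< ε ℚ.* B⁻¹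
      δ>0 = subst (ℚ._< ε ℚ.* B⁻¹) (ℚ.*-zeroˡ B⁻¹) (ℚ.*-monoˡ-<-pos B⁻¹ ε>0)
      δB≡ε : (ε ℚ.* B⁻¹) ℚ.* B ≡ ε
      δB≡ε = trans (ℚ.*-assoc ε B⁻¹ B)
        (trans (cong (ε ℚ.*_) (ℚ.*-inverseˡ B)) (ℚ.*-identityʳ ε))

    *-mono-≤-∣∣ : ∀ p q {r s} → 0ℚ ℚ.< s → ℚ.∣ p ∣ ℚ.≤ r → ℚ.∣ q ∣ ℚ.≤ s →
                  ℚ.∣ p ℚ.* q ∣ ℚ.≤ r ℚ.* s
    *-mono-≤-∣∣ p q {r} {s} s>0 p≤r q≤s = begin
        ℚ.∣ p ℚ.* q ∣
          ≡⟨ ℚ.∣p*q∣≡∣p∣*∣q∣ p q ⟩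
        ℚ.∣ p ∣ ℚ.* ℚ.∣ q ∣
          ≤⟨ ℚ.*-monoˡ-≤-nonNeg ℚ.∣ p ∣ q≤s ⟩
        ℚ.∣ p ∣ ℚ.* s
          ≤⟨ ℚ.*-monoʳ-≤-nonNeg s p≤r ⟩
        r ℚ.* s ∎
      where
      open ℚ.≤-Reasoning
      instance
        ∣p∣-nonNeg : ℚ.NonNegative ℚ.∣ p ∣
        ∣p∣-nonNeg = ℚ.∣-∣-nonNeg p
        s-nonNeg : ℚ.NonNegative s
        s-nonNeg = ℚ.nonNegative (ℚ.<⇒≤ s>0)

    difference-of-products : ∀ a b c d →
      a ℚ.* b ℚ.- c ℚ.* d ≡ (b ℚ.- d) ℚ.* a ℚ.+ (a ℚ.- c) ℚ.* d
    difference-of-products = solve 4 (λ a b c d →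
        a :* b :- c :* d := (b :- d) :* a :+ (a :- c) :* d) refl
      where open +-*-Solver

    product-close : ∀ a b c d {B C δ} → 0ℚ ℚ.< B → 0ℚ ℚ.< C →
      ℚ.∣ a ∣ ℚ.≤ B → ℚ.∣ d ∣ ℚ.≤ C →
      ℚ.∣ b ℚ.- d ∣ ℚ.≤ δ → ℚ.∣ a ℚ.- c ∣ ℚ.≤ δ →
      ℚ.∣ a ℚ.* b ℚ.- c ℚ.* d ∣ ℚ.≤ δ ℚ.* (B ℚ.+ C)
    product-close a b c d {B} {C} {δ} B>0 C>0 a≤B d≤C b-d≤δ a-c≤δ = begin
        ℚ.∣ a ℚ.* b ℚ.- c ℚ.* d ∣
          ≡⟨ cong ℚ.∣_∣ (difference-of-products a b c d) ⟩
        ℚ.∣ (b ℚ.- d) ℚ.* a ℚ.+ (a ℚ.- c) ℚ.* d ∣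
          ≤⟨ ℚ.∣p+q∣≤∣p∣+∣q∣ ((b ℚ.- d) ℚ.* a) ((a ℚ.- c) ℚ.* d) ⟩
        ℚ.∣ (b ℚ.- d) ℚ.* a ∣ ℚ.+ ℚ.∣ (a ℚ.- c) ℚ.* d ∣
          ≤⟨ ℚ.+-mono-≤ (*-mono-≤-∣∣ (b ℚ.- d) a B>0 b-d≤δ a≤B)
                        (*-mono-≤-∣∣ (a ℚ.- c) d C>0 a-c≤δ d≤C) ⟩
        δ ℚ.* B ℚ.+ δ ℚ.* C
          ≡⟨ sym (ℚ.*-distribˡ-+ δ B C) ⟩
        δ ℚ.* (B ℚ.+ C) ∎
      where open ℚ.≤-Reasoning

    *-cauchy : ∀ {x y} → IsCauchy x → IsCauchy y →
               IsCauchy (λ n → x n ℚ.* y n)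
    *-cauchy {x} {y} cx cy ε ε>0 =
      let B , B>0 , K , x≤B = bounded {x} cx
          C , C>0 , L , y≤C = bounded {y} cy
          δ , δ>0 , δ[B+C]≡ε = shrink (ℚ.+-mono-< B>0 C>0) ε>0
          M , p = cx δ δ>0
          N , q = cy δ δ>0
      in (K ℕ.⊔ L) ℕ.⊔ (M ℕ.⊔ N) , λ m n m≥ n≥ →
        let KL≤m = ℕ.m⊔n≤o⇒m≤o (K ℕ.⊔ L) (M ℕ.⊔ N) m≥
            KL≤n = ℕ.m⊔n≤o⇒m≤o (K ℕ.⊔ L) (M ℕ.⊔ N) n≥
            MN≤m = ℕ.m⊔n≤o⇒n≤o (K ℕ.⊔ L) (M ℕ.⊔ N) m≥
            MN≤n = ℕ.m⊔n≤o⇒n≤o (K ℕ.⊔ L) (M ℕ.⊔ N) n≥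
        in ℚ.≤-trans
             (product-close (x m) (y m) (x n) (y n) B>0 C>0
               (x≤B m (ℕ.m⊔n≤o⇒m≤o K L KL≤m))
               (y≤C n (ℕ.m⊔n≤o⇒n≤o K L KL≤n))
               (q m n (ℕ.m⊔n≤o⇒n≤o M N MN≤m) (ℕ.m⊔n≤o⇒n≤o M N MN≤n))
               (p m n (ℕ.m⊔n≤o⇒m≤o M N MN≤m) (ℕ.m⊔n≤o⇒m≤o M N MN≤n)))
             (ℚ.≤-reflexive δ[B+C]≡ε)

    const-cauchy : ∀ q → IsCauchy (λ _ → q)
    const-cauchy q ε ε>0 = 0 , λ _ _ _ _ →
      subst (ℚ._≤ ε) (sym (cong ℚ.∣_∣ (ℚ.+-inverseʳ q))) (ℚ.<⇒≤ ε>0)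

fromℚ : ℚ → ℝ
fromℚ q = mkℝ (λ _ → q) (const-cauchy q)

infix  8 -ʳ_
infixl 7 _*ʳ_
infixl 6 _+ʳ_
infix  4 _≈ʳ_ _≤ʳ_

_+ʳ_ : ℝ → ℝ → ℝ
x +ʳ y = mkℝ (λ n → seq x n ℚ.+ seq y n)
             (+-cauchy {seq x} {seq y} (cauchy x) (cauchy y))

_*ʳ_ : ℝ → ℝ → ℝ
x *ʳ y = mkℝ (λ n → seq x n ℚ.* seq y n)
             (*-cauchy {seq x} {seq y} (cauchy x) (cauchy y))

-ʳ_ : ℝ → ℝ
-ʳ x = mkℝ (λ n → ℚ.- seq x n) (neg-cauchy {seq x} (cauchy x))

_≈ʳ_ : ℝ → ℝ → Set
x ≈ʳ y = ∀ ε → 0ℚ ℚ.< ε →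
  Eventually (λ n → ℚ.∣ seq x n ℚ.- seq y n ∣ ℚ.≤ ε)

_≤ʳ_ : ℝ → ℝ → Set
x ≤ʳ y = ∀ ε → 0ℚ ℚ.< ε → Eventually (λ n → seq x n ℚ.≤ seq y n ℚ.+ ε)

ℝ-rawRing : RawRing 0ℓ 0ℓ
ℝ-rawRing = record
  { Carrier = ℝ ; _≈_ = _≈ʳ_ ; _+_ = _+ʳ_ ; _*_ = _*ʳ_ ; -_ = -ʳ_
  ; 0# = fromℚ 0ℚ ; 1# = fromℚ 1ℚ }

record ℂ : Set where
  constructor _+i_
  field
    re im : ℝ

open ℂ public

ℂ-rawRing : RawRing 0ℓ 0ℓ
ℂ-rawRing = record
  { Carrier = ℂ
  ; _≈_ = λ z w → re z ≈ʳ re w × im z ≈ʳ im w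
  ; _+_ = λ z w → (re z +ʳ re w) +i (im z +ʳ im w)
  ; _*_ = λ z w → (re z *ʳ re w +ʳ -ʳ (im z *ʳ im w))
                    +i (re z *ʳ im w +ʳ im z *ʳ re w)
  ; -_ = λ z → (-ʳ re z) +i (-ʳ im z)
  ; 0# = fromℚ 0ℚ +i fromℚ 0ℚ
  ; 1# = fromℚ 1ℚ +i fromℚ 0ℚ
  }

module ℂ-Ring = RawRing ℂ-rawRing

conj : ℂ → ℂ
conj z = re z +i (-ʳ im z)

∣_∣² : ℂ → ℝ
∣ z ∣² = re z *ʳ re z +ʳ im z *ʳ im z

-- Finite-dimensional state space spanned by the basis states |i,b,z⟩:
-- a position i, a register b with m values, and a workspace state z.

Basis : ℕ → ℕ → ℕ → Set
Basis n m d = Fin n × Fin m × Fin d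

_≟ᵇ_ : ∀ {n m d} → DecidableEquality (Basis n m d)
_≟ᵇ_ = ≡-dec Fin._≟_ (≡-dec Fin._≟_ Fin._≟_)

module BasisSum (R : RawRing 0ℓ 0ℓ) where
  open RawRing R using (Carrier; +-rawMonoid)
  open RawMonoidOps +-rawMonoid using (sum)

  ∑ : ∀ {n m d} → (Basis n m d → Carrier) → Carrier
  ∑ f = sum λ i → sum λ b → sum λ z → f (i , b , z)

open BasisSum ℝ-rawRing public using () renaming (∑ to ∑ʳ)
open BasisSum ℂ-rawRing public using () renaming (∑ to ∑ᶜ)

State : ℕ → ℕ → ℕ → Set
State n m d = Basis n m d → ℂ

Operator : ℕ → ℕ → ℕ → Set
Operator n m d = Basis n m d → Basis n m d → ℂ

module _ {n m d : ℕ} where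

  ∣_⟩ : Basis n m d → State n m d
  ∣ y ⟩ x = if ⌊ x ≟ᵇ y ⌋ then ℂ-Ring.1# else ℂ-Ring.0#

  infixr 7 _·_
  infixl 8 _⊗_
  infix  9 _†

  _·_ : Operator n m d → State n m d → State n m d
  (U · ψ) x = ∑ᶜ λ y → U x y ℂ-Ring.* ψ y

  _⊗_ : Operator n m d → Operator n m d → Operator n m d
  (U ⊗ V) x y = ∑ᶜ λ z → U x z ℂ-Ring.* V z y

  _† : Operator n m d → Operator n m d
  (U †) x y = conj (U y x)

  𝟙 : Operator n m d
  𝟙 x y = ∣ y ⟩ x

  IsUnitary : Operator n m d → Set
  IsUnitary U = (∀ x y → (U † ⊗ U) x y ℂ-Ring.≈ 𝟙 x y)
              × (∀ x y → (U ⊗ U †) x y ℂ-Ring.≈ 𝟙 x y)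

record Unitary (n m d : ℕ) : Set where
  field
    matrix    : Operator n m d
    isUnitary : IsUnitary matrix

open Unitary public

-- Strings of length n over the integer alphabet {0,…,σ-1}.

Str : ℕ → ℕ → Set
Str σ n = Vec (Fin σ) n

xorBit : Fin 2 → Fin 2 → Fin 2
xorBit zero       b = b
xorBit (suc zero) b = Fin.opposite b

-- Bitwise xor: finToFun lists the w binary digits of a number below 2 ^ w.
infixl 6 _⊕_
_⊕_ : ∀ {w} → Fin (2 ℕ.^ w) → Fin (2 ℕ.^ w) → Fin (2 ℕ.^ w)
_⊕_ {w} a b =
  Fin.funToFin λ j → xorBit (Fin.finToFun {2} {w} a j) (Fin.finToFun {2} {w} b j)

module _ {σ n w d : ℕ} (fits : σ ℕ.≤ 2 ℕ.^ w) where

  queryBasis : Str σ n → Basis n (2 ℕ.^ w) d → Basis n (2 ℕ.^ w) d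
  queryBasis s (i , b , z) = i , _⊕_ {w} b (Fin.inject≤ (lookup s i) fits) , z

  -- The column of the oracle indexed by y is |queryBasis s y⟩.
  oracle : Str σ n → Operator n (2 ℕ.^ w) d
  oracle s x y = ∣ queryBasis s y ⟩ x

-- An algorithm for inputs of length n making T queries.  The final state is
-- measured in the computational basis and outcome x yields output x.
-- The workspace dimension d is arbitrary.

record QueryAlgorithm (n w T : ℕ) : Set where
  field
    d        : ℕ
    start    : Basis n (2 ℕ.^ w) d
    unitary  : Vector (Unitary n (2 ℕ.^ w) d) (suc T)
    output   : Basis n (2 ℕ.^ w) d → ℕ

module _ {σ n w T : ℕ} (fits : σ ℕ.≤ 2 ℕ.^ w) (A : QueryAlgorithm n w T) where
  open QueryAlgorithm A

  -- U_T O_s U_{T-1} O_s ⋯ U_1 O_s U_0 |start⟩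
  finalState : Str σ n → State n (2 ℕ.^ w) d
  finalState s = Vector.foldl (λ ψ U → matrix U · oracle {w = w} fits s · ψ)
    (matrix (Vector.head unitary) · ∣ start ⟩) (Vector.tail unitary)

  Pr[output≡_] : ℕ → Str σ n → ℝ
  Pr[output≡ v ] s = ∑ʳ λ x →
    if ⌊ output x ℕ.≟ v ⌋ then ∣ finalState s x ∣² else fromℚ 0ℚ

  -- The answer on s is specified by the relation Answer s.
  Computes : (Str σ n → ℕ → Set) → Set
  Computes Answer = ∀ s v → Answer s v →
    fromℚ (+ 2 ℚ./ 3) ≤ʳ Pr[output≡ v ] s

module _ {σ n : ℕ} where

  -- s [ i ⋯ j ⟩ is s[i..j) = s[i] ⋯ s[j-1], with 1-indexed positions.
  _[_⋯_⟩ : Str σ n → ℕ → ℕ → List (Fin σ)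
  s [ i ⋯ j ⟩ = take (j ℕ.∸ i) (drop (i ℕ.∸ 1) (toList s))

  -- The bound i ≤ n - 2Δ + 1 is written without truncated subtraction.
  HasSquare : Str σ n → ℕ → Set
  HasSquare s Δ = ∃[ i ] (1 ℕ.≤ i × i ℕ.+ 2 ℕ.* Δ ℕ.≤ n ℕ.+ 1 ×
    s [ i ⋯ i ℕ.+ Δ ⟩ ≡ s [ i ℕ.+ Δ ⋯ i ℕ.+ 2 ℕ.* Δ ⟩)

  IsLongestSquareShift : Str σ n → ℕ → Set
  IsLongestSquareShift s Δ =
    HasSquare s Δ × (∀ Δ′ → HasSquare s Δ′ → Δ′ ℕ.≤ Δ)

-- For naturals, √n ≤ m means n ≤ m²; thus √ n ≤ k * T says T ≥ (1/k) √n.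

infix 4 √_≤_
√_≤_ : ℕ → ℕ → Set
√ n ≤ m = n ℕ.≤ m ℕ.^ 2

{-# OPTIONS --safe #-}

-- BBBV hybrid argument.  The constant string has longest square shift ⌊n/2⌋,
-- whereas for each of the N = n − 2 interior positions j, writing a second
-- letter at j destroys every square of that shift.  So the final states ψ on the constant
-- string and φ_j on the j-th modified string must be distinguishable, which
-- bounds Re⟨φ_j , ψ⟩ away from 1.  Unitaries preserve Re⟨φ_j , ψ⟩, and a query
-- changes only the part supported on position j; by Young's inequality its
-- scaled loss 2q·Re⟨φ_j , ψ⟩ is at most 2‖P_j φ_j‖² + 2q²‖P_j ψ‖².  Summed over
-- j, each query costs at most 2(N + q²), because Σ_j ‖P_j ψ‖² ≤ 1.  With T
-- queries and q = 36T this forces N ≤ q².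
--
-- Young's inequality with integer weights replaces Cauchy–Schwarz, so no square
-- roots or divisions of reals occur: the reals enter only as an ordered
-- commutative monoid with natural multiples k ⊠ x.
module Submission where

open import Defs
open import Algebra.Bundles using (CommutativeMonoid; CommutativeRing)
import Algebra.Properties.CommutativeMonoid.Mult as Mult
import Algebra.Properties.CommutativeMonoid.Sum as Sum
import Algebra.Solver.CommutativeMonoid as CommutativeMonoidSolver
open import Data.Bool.Base using (if_then_else_)
open import Data.Fin.Base as Fin using (Fin; zero; suc; inject₁)
open import Data.Fin.Permutation using (Permutation′; permutation)
import Data.Fin.Properties as Fin
open import Data.Integer.Base using (+_)
open import Data.List.Base as List using (List; []; _∷_; take; drop)
import Data.List.Properties as List
open import Data.Maybe.Base using (Maybe; just; nothing)
open import Data.Maybe.Properties using (just-injective)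
open import Data.Nat.Base as ℕ using (ℕ; zero; suc; _≤_; _*_; _^_; _∸_; ⌊_/2⌋)
import Data.Nat.Properties as ℕ
open import Data.Nat.Tactic.RingSolver using (solve-∀)
open import Data.Product.Base using (_×_; _,_; proj₁; proj₂; ∃-syntax)
open import Data.Rational.Base as ℚ using (ℚ; 0ℚ; 1ℚ; ½)
import Data.Rational.Properties as ℚ
open import Data.Rational.Solver using (module +-*-Solver)
open import Data.Sum.Base using (inj₁; inj₂)
open import Data.Vec.Base as Vec using (Vec; []; _∷_; lookup; toList; _[_]≔_)
open import Data.Vec.Functional as Vector using (Vector)
import Data.Vec.Properties as Vec
open import Function.Base using (_∘_; _$_)
open import Level using (0ℓ)
open import Relation.Binary.Bundles using (Preorder)
open import Relation.Binary.PropositionalEquality as ≡ using (_≡_; _≢_)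
import Relation.Binary.Reasoning.Preorder as PreorderReasoning
import Relation.Binary.Reasoning.Setoid as SetoidReasoning
open import Relation.Binary.Structures using (IsEquivalence; IsPreorder)
open import Relation.Nullary.Decidable
  using (Dec; yes; no; ⌊_⌋; from-yes; from-no; map′; _×-dec_)
open import Relation.Nullary.Negation using (¬_; contradiction)
open import Algebra.Properties.Semiring.Mult (CommutativeRing.semiring ℚ.+-*-commutativeRing)
  using (×1-homo-*) renaming (_×_ to _×ℚ_)

-- Finite sums

-- The usual hybrid argument adds up distances between states by the triangle inequality, and
-- distances are square roots. The real part of the inner product stays quadratic: a unitary
-- preserves it exactly, and a query changes it only at the marked position. Since a monoid has no
-- subtraction, a loss never appears as a difference; each inequality has the earlier overlap on the
-- left and the later overlap plus a cost on the right.
--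
-- The constant 36 arises as follows. Success probability 2/3 on two different answers forces a
-- final overlap of at most 68/72, a loss of 1/18 for each j. The N initial overlaps are all 1, so
-- the total scaled loss `2qN/18` is at most `2T(N + q²)`, that is `qN ≤ 18T(N + q²)`. Taking q =
-- 18T would only cancel the left side; twice that value leaves `18TN ≤ 18Tq²`.
--
-- The proof needs no knowledge of the longest square shift of a modified string beyond its
-- difference from ⌊n/2⌋. It must exist, however, because correctness constrains the algorithm only
-- at a value that is an answer.

module FiniteSums (M : CommutativeMonoid 0ℓ 0ℓ) where
  open CommutativeMonoid M renaming
    ( _∙_ to _+_; ε to 0#; ∙-cong to +-cong; ∙-congˡ to +-congˡ
    ; identityˡ to +-identityˡ; identityʳ to +-identityʳ )
  open Sum M
  open SetoidReasoning setoid

  sum-vanishes : ∀ {n} {f : Vector Carrier n} → (∀ i → f i ≈ 0#) → sum f ≈ 0#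
  sum-vanishes {n} f≈0 = trans (sum-cong-≋ f≈0) (sum-replicate-zero n)

  sum-single : ∀ {n} (f : Vector Carrier n) i → (∀ j → j ≢ i → f j ≈ 0#) → sum f ≈ f i
  sum-single {suc n} f zero f≈0 = begin
    f zero + sum (f ∘ suc) ≈⟨ +-congˡ (sum-vanishes {n} λ j → f≈0 (suc j) λ ()) ⟩
    f zero + 0#            ≈⟨ +-identityʳ _ ⟩
    f zero                 ∎
  sum-single {suc n} f (suc i) f≈0 = begin
    f zero + sum (f ∘ suc) ≈⟨ +-cong (f≈0 zero λ ())
                                (sum-single (f ∘ suc) i λ j j≢i → f≈0 (suc j) (j≢i ∘ Fin.suc-injective)) ⟩
    0# + f (suc i)         ≈⟨ +-identityˡ _ ⟩
    f (suc i)              ∎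

module BasisSums (M : CommutativeMonoid 0ℓ 0ℓ) (n m d : ℕ) where
  open CommutativeMonoid M renaming (_∙_ to _+_; ε to 0#; ∙-congˡ to +-congˡ)
  open Sum M
  open FiniteSums M
  open SetoidReasoning setoid

  ∑ : (Basis n m d → Carrier) → Carrier
  ∑ f = sum λ i → sum λ b → sum λ z → f (i , b , z)

  ∑-cong : {f g : Basis n m d → Carrier} → (∀ x → f x ≈ g x) → ∑ f ≈ ∑ g
  ∑-cong f≈g = sum-cong-≋ {n} λ i → sum-cong-≋ {m} λ b → sum-cong-≋ {d} λ z → f≈g (i , b , z)

  ∑-vanishes : {f : Basis n m d → Carrier} → (∀ x → f x ≈ 0#) → ∑ f ≈ 0#
  ∑-vanishes f≈0 = sum-vanishes {n} λ i → sum-vanishes {m} λ b → sum-vanishes {d} λ z → f≈0 (i , b , z)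

  ∑-homo-+ : (f g : Basis n m d → Carrier) → ∑ (λ x → f x + g x) ≈ ∑ f + ∑ g
  ∑-homo-+ f g = trans
    (sum-cong-≋ {n} λ i → trans (sum-cong-≋ {m} λ b → ∑-distrib-+ {d} _ _) (∑-distrib-+ {m} _ _))
    (∑-distrib-+ {n} _ _)

  sum-∑-comm : ∀ {k} (f : Fin k → Basis n m d → Carrier) →
               sum (λ i → ∑ (f i)) ≈ ∑ λ x → sum λ i → f i x
  sum-∑-comm {zero}  f = sym (∑-vanishes λ _ → refl)
  sum-∑-comm {suc k} f = begin
    ∑ (f zero) + sum (λ i → ∑ (f (suc i)))       ≈⟨ +-congˡ (sum-∑-comm (f ∘ suc)) ⟩
    ∑ (f zero) + ∑ (λ x → sum λ i → f (suc i) x) ≈⟨ ∑-homo-+ _ _ ⟨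
    ∑ (λ x → sum λ i → f i x)                    ∎

  ∑-swap : ∀ (f : Basis n m d → Basis n m d → Carrier) →
           ∑ (λ y → ∑ (f y)) ≈ ∑ λ x → ∑ λ y → f y x
  ∑-swap f = trans
    (sum-cong-≋ {n} λ i → trans (sum-cong-≋ {m} λ b → sum-∑-comm {d} _) (sum-∑-comm {m} _))
    (sum-∑-comm {n} _)

  ∑-single : ∀ (f : Basis n m d → Carrier) x → (∀ y → y ≢ x → f y ≈ 0#) → ∑ f ≈ f x
  ∑-single f (i , b , z) f≈0 =
    trans (sum-single _ i λ i′ i′≢i → sum-vanishes {m} λ b′ → sum-vanishes {d} λ z′ →
             f≈0 _ (i′≢i ∘ ≡.cong proj₁)) $
    trans (sum-single _ b λ b′ b′≢b → sum-vanishes {d} λ z′ →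
             f≈0 _ (b′≢b ∘ ≡.cong (proj₁ ∘ proj₂))) $
    sum-single _ z λ z′ z′≢z → f≈0 _ (z′≢z ∘ ≡.cong (proj₂ ∘ proj₂))

module SumHomomorphism (M N : CommutativeMonoid 0ℓ 0ℓ) where
  private
    module M = CommutativeMonoid M
    module N = CommutativeMonoid N
    module SM = Sum M
    module SN = Sum N

  module _ (h : M.Carrier → N.Carrier) (h-ε : h M.ε N.≈ N.ε)
           (h-∙ : ∀ x y → h (x M.∙ y) N.≈ h x N.∙ h y) where

    sum-homo : ∀ {n} (f : Vector M.Carrier n) → h (SM.sum f) N.≈ SN.sum (h ∘ f)
    sum-homo {zero}  f = h-ε
    sum-homo {suc n} f = N.trans (h-∙ _ _) (N.∙-congˡ (sum-homo (f ∘ suc)))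

    ∑-homo : ∀ {n m d} (f : Basis n m d → M.Carrier) →
             h (BasisSums.∑ M n m d f) N.≈ BasisSums.∑ N n m d (h ∘ f)
    ∑-homo {n} {m} {d} f =
      N.trans (sum-homo {n} _) (SN.sum-cong-≋ {n} λ i →
      N.trans (sum-homo {m} _) (SN.sum-cong-≋ {m} λ b → sum-homo {d} _))

-- Ordered commutative monoids and sums of inequalities

record OrderedMonoid : Set₁ where
  field
    commutativeMonoid : CommutativeMonoid 0ℓ 0ℓ
  open CommutativeMonoid commutativeMonoid public renaming
    ( _∙_ to _+_; ε to 0#; ∙-cong to +-cong; ∙-congˡ to +-congˡ; ∙-congʳ to +-congʳ
    ; assoc to +-assoc; comm to +-comm
    ; identityˡ to +-identityˡ; identityʳ to +-identityʳ )
  infix 4 _≲_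
  field
    _≲_        : Carrier → Carrier → Set
    isPreorder : IsPreorder _≈_ _≲_
    +-mono     : ∀ {x y u v} → x ≲ y → u ≲ v → x + u ≲ y + v
  preorder : Preorder 0ℓ 0ℓ 0ℓ
  preorder = record { isPreorder = isPreorder }
  open IsPreorder isPreorder public using () renaming
    (reflexive to ≲-reflexive; refl to ≲-refl; trans to ≲-trans)

module OrderedSums (R : OrderedMonoid) where
  open OrderedMonoid R
  open Sum commutativeMonoid public
  open Mult commutativeMonoid public renaming (_×_ to infixr 8 _⊠_)
  module R-Reasoning = PreorderReasoning preorder
  open R-Reasoning

  +-monoˡ : ∀ {x y} z → x ≲ y → x + z ≲ y + z
  +-monoˡ z x≲y = +-mono x≲y ≲-refl

  +-monoʳ : ∀ {x y} z → x ≲ y → z + x ≲ z + y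
  +-monoʳ z = +-mono ≲-refl

  ⊠-mono : ∀ n {x y} → x ≲ y → n ⊠ x ≲ n ⊠ y
  ⊠-mono zero    x≲y = ≲-refl
  ⊠-mono (suc n) x≲y = +-mono x≲y (⊠-mono n x≲y)

  ⊠-zero : ∀ n → n ⊠ 0# ≈ 0#
  ⊠-zero zero    = refl
  ⊠-zero (suc n) = trans (+-identityˡ _) (⊠-zero n)

  ≲-+ʳ : ∀ x {y} → 0# ≲ y → x ≲ x + y
  ≲-+ʳ x {y} 0≲y = begin
    x      ≈⟨ +-identityʳ x ⟨
    x + 0# ≲⟨ +-monoʳ x 0≲y ⟩
    x + y  ∎

  ≲-+ˡ : ∀ x {y} → 0# ≲ y → x ≲ y + x
  ≲-+ˡ x {y} 0≲y = ≲-trans (≲-+ʳ x 0≲y) (≲-reflexive (+-comm x y))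

  sum-mono : ∀ {n} {f g : Vector Carrier n} → (∀ i → f i ≲ g i) → sum f ≲ sum g
  sum-mono {zero}  f≲g = ≲-refl
  sum-mono {suc n} f≲g = +-mono (f≲g zero) (sum-mono (f≲g ∘ suc))

  -- Serves a pair of oracles that agree off position `i`: only the summand at `i` can lose, and `c`
  -- is the price of that loss.
  sum-mono-at : ∀ {n} (f g : Vector Carrier n) i c → (∀ j → j ≢ i → f j ≲ g j) →
                f i ≲ g i + c → sum f ≲ sum g + c
  sum-mono-at {suc n} f g zero c f≲g fi≲ = begin
    f zero + sum (f ∘ suc)         ≲⟨ +-mono fi≲ (sum-mono λ j → f≲g (suc j) λ ()) ⟩
    (g zero + c) + sum (g ∘ suc)   ≈⟨ solve 3 (λ a b c → (a :+ b) :+ c ⊜ (a :+ c) :+ b) refl _ _ _ ⟩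
    (g zero + sum (g ∘ suc)) + c   ∎
    where open CommutativeMonoidSolver commutativeMonoid renaming (_⊕_ to _:+_)
  sum-mono-at {suc n} f g (suc i) c f≲g fi≲ = begin
    f zero + sum (f ∘ suc)         ≲⟨ +-mono (f≲g zero λ ())
      (sum-mono-at (f ∘ suc) (g ∘ suc) i c (λ j j≢i → f≲g (suc j) (j≢i ∘ Fin.suc-injective)) fi≲) ⟩
    g zero + (sum (g ∘ suc) + c)   ≈⟨ +-assoc _ _ _ ⟨
    (g zero + sum (g ∘ suc)) + c   ∎

  sum-nonneg : ∀ {n} {f : Vector Carrier n} → (∀ i → 0# ≲ f i) → 0# ≲ sum f
  sum-nonneg {n} 0≲f = ≲-trans (≲-reflexive (sym (sum-replicate-zero n))) (sum-mono 0≲f)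

  term≲sum : ∀ {n} {f : Vector Carrier n} → (∀ i → 0# ≲ f i) → ∀ i → f i ≲ sum f
  term≲sum 0≲f zero    = ≲-+ʳ _ (sum-nonneg (0≲f ∘ suc))
  term≲sum 0≲f (suc i) = ≲-trans (term≲sum (0≲f ∘ suc) i) (≲-+ˡ _ (0≲f zero))

  -- The two end positions are never modified, so the masses at modified positions form only part of
  -- the full sum.
  sum-interior : ∀ {n} (f : Vector Carrier (suc (suc n))) → (∀ i → 0# ≲ f i) →
                 sum (λ j → f (suc (inject₁ j))) ≲ sum f
  sum-interior f 0≲f = begin
    sum (f ∘ suc ∘ inject₁)             ≲⟨ ≲-+ʳ _ (0≲f _) ⟩
    sum (f ∘ suc ∘ inject₁) + Vector.last (f ∘ suc) ≈⟨ sum-init-last (f ∘ suc) ⟨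
    sum (f ∘ suc)                       ≲⟨ ≲-+ˡ _ (0≲f zero) ⟩
    sum f                               ∎

  sum-⊠ : ∀ {n} k (f : Vector Carrier n) → k ⊠ sum f ≈ sum (λ i → k ⊠ f i)
  sum-⊠ k = sum-homo (k ⊠_) (⊠-zero k) (λ x y → ×-distrib-+ x y k)
    where open SumHomomorphism commutativeMonoid commutativeMonoid

module OrderedBasisSums (R : OrderedMonoid) (n m d : ℕ) where
  open OrderedMonoid R
  open OrderedSums R
  open BasisSums commutativeMonoid n m d public

  ∑-mono : {f g : Basis n m d → Carrier} → (∀ x → f x ≲ g x) → ∑ f ≲ ∑ g
  ∑-mono f≲g = sum-mono {n} λ i → sum-mono {m} λ b → sum-mono {d} λ z → f≲g (i , b , z)

  ∑-⊠ : ∀ k (f : Basis n m d → Carrier) → k ⊠ ∑ f ≈ ∑ (λ i → k ⊠ f i)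
  ∑-⊠ k = ∑-homo (k ⊠_) (⊠-zero k) (λ x y → ×-distrib-+ x y k)
    where open SumHomomorphism commutativeMonoid commutativeMonoid

-- Hybrid argument over abstract amplitudes

module _ {A P : Set} {x y : A} where

  if-yes : (p? : Dec P) → P → (if ⌊ p? ⌋ then x else y) ≡ x
  if-yes (yes _) p = ≡.refl
  if-yes (no ¬p) p = contradiction p ¬p

  if-no : (p? : Dec P) → ¬ P → (if ⌊ p? ⌋ then x else y) ≡ y
  if-no (yes p) ¬p = contradiction p ¬p
  if-no (no _)  ¬p = ≡.refl

-- Keeping the complex numbers abstract makes _≈_ neutral, which unification needs: the
-- concrete equality of Cauchy sequences unfolds and loses its arguments.
record Amplitudes : Set₁ where
  field
    reals : OrderedMonoid
    ring  : CommutativeRing 0ℓ 0ℓ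
  module ℛ = OrderedMonoid reals
  module 𝒞 = CommutativeRing ring
  open OrderedSums reals using (_⊠_)
  field
    star      : 𝒞.Carrier → 𝒞.Carrier
    star-cong : ∀ {a b} → a 𝒞.≈ b → star a 𝒞.≈ star b
    star-0    : star 𝒞.0# 𝒞.≈ 𝒞.0#
    star-1    : star 𝒞.1# 𝒞.≈ 𝒞.1#
    star-+    : ∀ a b → star (a 𝒞.+ b) 𝒞.≈ star a 𝒞.+ star b
    star-*    : ∀ a b → star (a 𝒞.* b) 𝒞.≈ star a 𝒞.* star b
    real      : 𝒞.Carrier → ℛ.Carrier
    real-cong : ∀ {a b} → a 𝒞.≈ b → real a ℛ.≈ real b
    real-0    : real 𝒞.0# ℛ.≈ ℛ.0#
    real-+    : ∀ a b → real (a 𝒞.+ b) ℛ.≈ real a ℛ.+ real b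
  ⟪_,_⟫ : 𝒞.Carrier → 𝒞.Carrier → ℛ.Carrier
  ⟪ a , b ⟫ = real (star a 𝒞.* b)
  field
    ⟪⟫-nonneg : ∀ a → ℛ.0# ℛ.≲ ⟪ a , a ⟫
    young⁺    : ∀ p q a b → (2 * (p * q)) ⊠ ⟪ a , b ⟫ ℛ.≲
                            (p * p) ⊠ ⟪ a , a ⟫ ℛ.+ (q * q) ⊠ ⟪ b , b ⟫
    young⁻    : ∀ p q a b → ℛ.0# ℛ.≲ (2 * (p * q)) ⊠ ⟪ a , b ⟫ ℛ.+
                            ((p * p) ⊠ ⟪ a , a ⟫ ℛ.+ (q * q) ⊠ ⟪ b , b ⟫)

-- States, operators and the real part of the inner product

module InnerProduct (𝒜 : Amplitudes) (n m d : ℕ) where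
  open Amplitudes 𝒜
  open 𝒞 using () renaming (Carrier to Amp)
  private
    module ∑𝒞 = BasisSums 𝒞.+-commutativeMonoid n m d
    module ∑ℛ = OrderedBasisSums reals n m d

  St : Set
  St = Basis n m d → Amp

  Op : Set
  Op = Basis n m d → Basis n m d → Amp

  infixr 7 _▹_
  _▹_ : Op → St → St
  (U ▹ ψ) x = ∑𝒞.∑ λ y → U x y 𝒞.* ψ y

  basis : Basis n m d → St
  basis y x = if ⌊ x ≟ᵇ y ⌋ then 𝒞.1# else 𝒞.0#

  basis-≡ : ∀ {x y} → x ≡ y → basis y x ≡ 𝒞.1#
  basis-≡ {x} {y} = if-yes (x ≟ᵇ y)

  basis-≢ : ∀ {x y} → x ≢ y → basis y x ≡ 𝒞.0#
  basis-≢ {x} {y} = if-no (x ≟ᵇ y)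

  Isometry : Op → Set
  Isometry U = ∀ x y → ∑𝒞.∑ (λ z → star (U z x) 𝒞.* U z y) 𝒞.≈ basis y x

  ∑-basis : ∀ y (ψ : St) → ∑𝒞.∑ (λ x → basis y x 𝒞.* ψ x) 𝒞.≈ ψ y
  ∑-basis y ψ = 𝒞.trans
    (∑𝒞.∑-single _ y λ x x≢y → 𝒞.trans (𝒞.*-congʳ (𝒞.reflexive (basis-≢ x≢y))) (𝒞.zeroˡ _))
    (𝒞.trans (𝒞.*-congʳ (𝒞.reflexive (basis-≡ {y} ≡.refl))) (𝒞.*-identityˡ _))

  basis-sym : ∀ x y → basis y x ≡ basis x y
  basis-sym x y with x ≟ᵇ y
  ... | yes x≡y = ≡.sym (basis-≡ (≡.sym x≡y))
  ... | no  x≢y = ≡.sym (basis-≢ (x≢y ∘ ≡.sym))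

  module _ where
    open SumHomomorphism 𝒞.+-commutativeMonoid 𝒞.+-commutativeMonoid

    *-distribˡ-∑ : ∀ a (ψ : St) → a 𝒞.* ∑𝒞.∑ ψ 𝒞.≈ ∑𝒞.∑ (λ x → a 𝒞.* ψ x)
    *-distribˡ-∑ a = ∑-homo (a 𝒞.*_) (𝒞.zeroʳ a) (𝒞.distribˡ a)

    *-distribʳ-∑ : ∀ a (ψ : St) → ∑𝒞.∑ ψ 𝒞.* a 𝒞.≈ ∑𝒞.∑ (λ x → ψ x 𝒞.* a)
    *-distribʳ-∑ a = ∑-homo (𝒞._* a) (𝒞.zeroˡ a) (λ x y → 𝒞.distribʳ a x y)

    star-∑ : (ψ : St) → star (∑𝒞.∑ ψ) 𝒞.≈ ∑𝒞.∑ (star ∘ ψ)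
    star-∑ = ∑-homo star star-0 star-+

  inner : St → St → Amp
  inner φ ψ = ∑𝒞.∑ λ x → star (φ x) 𝒞.* ψ x

  adjoint : Op → Op
  adjoint U x y = star (U y x)

  inner-adjoint : ∀ U φ ψ → inner (U ▹ φ) ψ 𝒞.≈ inner φ (adjoint U ▹ ψ)
  inner-adjoint U φ ψ = begin
    ∑𝒞.∑ (λ x → star (∑𝒞.∑ λ y → U x y 𝒞.* φ y) 𝒞.* ψ x)
      ≈⟨ ∑𝒞.∑-cong (λ x → 𝒞.trans (𝒞.*-congʳ (star-∑ _)) (*-distribʳ-∑ _ _)) ⟩
    ∑𝒞.∑ (λ x → ∑𝒞.∑ λ y → star (U x y 𝒞.* φ y) 𝒞.* ψ x)
      ≈⟨ ∑𝒞.∑-swap _ ⟩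
    ∑𝒞.∑ (λ y → ∑𝒞.∑ λ x → star (U x y 𝒞.* φ y) 𝒞.* ψ x)
      ≈⟨ ∑𝒞.∑-cong (λ y → ∑𝒞.∑-cong λ x → rearrange x y) ⟩
    ∑𝒞.∑ (λ y → ∑𝒞.∑ λ x → star (φ y) 𝒞.* (star (U x y) 𝒞.* ψ x))
      ≈⟨ ∑𝒞.∑-cong (λ y → *-distribˡ-∑ _ _) ⟨
    ∑𝒞.∑ (λ y → star (φ y) 𝒞.* ∑𝒞.∑ λ x → star (U x y) 𝒞.* ψ x) ∎
    where
    open SetoidReasoning 𝒞.setoid
    rearrange : ∀ x y → star (U x y 𝒞.* φ y) 𝒞.* ψ x 𝒞.≈ star (φ y) 𝒞.* (star (U x y) 𝒞.* ψ x)
    rearrange x y = 𝒞.trans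
      (𝒞.*-congʳ (𝒞.trans (star-* _ _) (𝒞.*-comm _ _))) (𝒞.*-assoc _ _ _)

  adjoint-▹-▹ : ∀ {U} → Isometry U → ∀ ψ x → (adjoint U ▹ U ▹ ψ) x 𝒞.≈ ψ x
  adjoint-▹-▹ {U} iso ψ x = begin
    ∑𝒞.∑ (λ z → star (U z x) 𝒞.* ∑𝒞.∑ λ y → U z y 𝒞.* ψ y)
      ≈⟨ ∑𝒞.∑-cong (λ z → 𝒞.trans (*-distribˡ-∑ _ _) (∑𝒞.∑-cong λ y → 𝒞.sym (𝒞.*-assoc _ _ _))) ⟩
    ∑𝒞.∑ (λ z → ∑𝒞.∑ λ y → (star (U z x) 𝒞.* U z y) 𝒞.* ψ y)
      ≈⟨ ∑𝒞.∑-swap _ ⟩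
    ∑𝒞.∑ (λ y → ∑𝒞.∑ λ z → (star (U z x) 𝒞.* U z y) 𝒞.* ψ y)
      ≈⟨ ∑𝒞.∑-cong (λ y → 𝒞.trans (𝒞.sym (*-distribʳ-∑ _ _)) (𝒞.*-congʳ
           (𝒞.trans (iso x y) (𝒞.reflexive (basis-sym x y))))) ⟩
    ∑𝒞.∑ (λ y → basis x y 𝒞.* ψ y)
      ≈⟨ ∑-basis x ψ ⟩
    ψ x ∎
    where open SetoidReasoning 𝒞.setoid

  Re⟨_,_⟩ : St → St → ℛ.Carrier
  Re⟨ φ , ψ ⟩ = ∑ℛ.∑ λ x → ⟪ φ x , ψ x ⟫

  real-inner : ∀ φ ψ → real (inner φ ψ) ℛ.≈ Re⟨ φ , ψ ⟩
  real-inner φ ψ =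
    SumHomomorphism.∑-homo 𝒞.+-commutativeMonoid ℛ.commutativeMonoid real real-0 real-+ {n} {m} {d} _

  ⟪⟫-cong : ∀ {a a′ b b′} → a 𝒞.≈ a′ → b 𝒞.≈ b′ → ⟪ a , b ⟫ ℛ.≈ ⟪ a′ , b′ ⟫
  ⟪⟫-cong a≈a′ b≈b′ = real-cong (𝒞.*-cong (star-cong a≈a′) b≈b′)

  Re⟨⟩-cong : ∀ {φ φ′ ψ ψ′} → (∀ x → φ x 𝒞.≈ φ′ x) → (∀ x → ψ x 𝒞.≈ ψ′ x) →
              Re⟨ φ , ψ ⟩ ℛ.≈ Re⟨ φ′ , ψ′ ⟩
  Re⟨⟩-cong φ≈φ′ ψ≈ψ′ = ∑ℛ.∑-cong λ x → ⟪⟫-cong (φ≈φ′ x) (ψ≈ψ′ x)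

  -- Moving `U` across the complex inner product produces `adjoint U ▹ U`, which acts as the
  -- identity; the real part is taken only at the two ends.
  Re⟨⟩-isometry : ∀ {U} → Isometry U → ∀ φ ψ → Re⟨ U ▹ φ , U ▹ ψ ⟩ ℛ.≈ Re⟨ φ , ψ ⟩
  Re⟨⟩-isometry {U} iso φ ψ = begin
    Re⟨ U ▹ φ , U ▹ ψ ⟩          ≈⟨ real-inner _ _ ⟨
    real (inner (U ▹ φ) (U ▹ ψ)) ≈⟨ real-cong (inner-adjoint U φ (U ▹ ψ)) ⟩
    real (inner φ (adjoint U ▹ U ▹ ψ))
      ≈⟨ real-cong (∑𝒞.∑-cong λ x → 𝒞.*-congˡ (adjoint-▹-▹ {U} iso ψ x)) ⟩
    real (inner φ ψ)             ≈⟨ real-inner φ ψ ⟩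
    Re⟨ φ , ψ ⟩                  ∎
    where open SetoidReasoning ℛ.setoid

  -- The real number one. The abstract reals are only an additive monoid, so it is obtained from the
  -- complex one.
  unit : ℛ.Carrier
  unit = real 𝒞.1#

  Re⟨⟩-basis : ∀ y → Re⟨ basis y , basis y ⟩ ℛ.≈ unit
  Re⟨⟩-basis y = begin
    Re⟨ basis y , basis y ⟩     ≈⟨ ∑ℛ.∑-single _ y (λ x x≢y → ℛ.trans
      (real-cong (𝒞.trans (𝒞.*-congˡ (𝒞.reflexive (basis-≢ x≢y))) (𝒞.zeroʳ _))) real-0) ⟩
    ⟪ basis y y , basis y y ⟫   ≈⟨ ⟪⟫-cong (𝒞.reflexive (basis-≡ {y} ≡.refl)) (𝒞.reflexive (basis-≡ {y} ≡.refl)) ⟩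
    ⟪ 𝒞.1# , 𝒞.1# ⟫             ≈⟨ real-cong (𝒞.trans (𝒞.*-congʳ star-1) (𝒞.*-identityˡ _)) ⟩
    unit                        ∎
    where open SetoidReasoning ℛ.setoid

-- The effect of a query on inner products

module Hybrid (𝒜 : Amplitudes) (n m d : ℕ) where
  open Amplitudes 𝒜
  open InnerProduct 𝒜 n m d
  open ℛ hiding (preorder)
  open OrderedSums reals
  private module ∑𝒞 = BasisSums 𝒞.+-commutativeMonoid n m d
  open R-Reasoning

  -- One involution of the register for each position; XOR with a character is the example.
  record Flips : Set where
    field
      flip       : Fin n → Fin m → Fin m
      involutive : ∀ i b → flip i (flip i b) ≡ b

    onBasis : Basis n m d → Basis n m d
    onBasis (i , b , z) = i , flip i b , z

    query : Op
    query x y = basis (onBasis y) x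

    onBasis-involutive : ∀ x → onBasis (onBasis x) ≡ x
    onBasis-involutive (i , b , z) = ≡.cong (λ c → i , c , z) (involutive i b)

    permutationAt : Fin n → Permutation′ m
    permutationAt i = permutation (flip i) (flip i) (involutive i) (involutive i)

    -- Only the preimage of `x` contributes to the matrix product, and an involution has equal image
    -- and preimage.
    query-▹ : ∀ ψ x → (query ▹ ψ) x 𝒞.≈ ψ (onBasis x)
    query-▹ ψ x = 𝒞.trans
      (∑𝒞.∑-single _ (onBasis x) λ y y≢ → 𝒞.trans
        (𝒞.*-congʳ (𝒞.reflexive (basis-≢ λ x≡ → y≢
          (≡.trans (≡.sym (onBasis-involutive y)) (≡.cong onBasis (≡.sym x≡))))))
        (𝒞.zeroˡ _))
      (𝒞.trans (𝒞.*-congʳ (𝒞.reflexive (basis-≡ (≡.sym (onBasis-involutive x)))))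
               (𝒞.*-identityˡ _))

  open Flips

  -- The real part of ⟨P_i φ, ψ⟩, where P_i projects onto position `i`. Its sum over `i` is
  -- `Re⟨ φ , ψ ⟩` by definition.
  at : Fin n → St → St → Carrier
  at i φ ψ = sum λ b → sum λ z → ⟪ φ (i , b , z) , ψ (i , b , z) ⟫

  at-⊠ : ∀ k i φ ψ →
         k ⊠ at i φ ψ ≈ sum λ b → sum λ z → k ⊠ ⟪ φ (i , b , z) , ψ (i , b , z) ⟫
  at-⊠ k i φ ψ = trans (sum-⊠ {m} k _) (sum-cong-≋ {m} λ b → sum-⊠ {d} k _)

  -- At a fixed position a query merely permutes the register, so equal permutations on both sides
  -- only reorder the sum. Taking `F` and `F′` equal, this also shows that a query preserves the
  -- mass at each position.
  at-onBasis : ∀ (F F′ : Flips) i → (∀ b → flip F i b ≡ flip F′ i b) → ∀ φ ψ →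
               at i (φ ∘ onBasis F) (ψ ∘ onBasis F′) ≈ at i φ ψ
  at-onBasis F F′ i F≗F′ φ ψ = trans
    (sum-cong-≋ {m} λ b → sum-cong-≋ {d} λ z →
      reflexive (≡.cong (λ c → ⟪ φ (i , flip F i b , z) , ψ (i , c , z) ⟫) (≡.sym (F≗F′ b))))
    (sym (sum-permute {m} {m} (λ b → sum λ z → ⟪ φ (i , b , z) , ψ (i , b , z) ⟫) (permutationAt F i)))

  at-nonneg : ∀ i φ → 0# ≲ at i φ φ
  at-nonneg i φ = sum-nonneg {m} λ b → sum-nonneg {d} λ z → ⟪⟫-nonneg _

  -- The coefficients keep the shape that young⁺ 1 q produces, so that they match definitionally.
  mass : ℕ → Fin n → St → St → Carrier
  mass q i φ ψ = (1 * 1) ⊠ at i φ φ + (q * q) ⊠ at i ψ ψ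

  private
    mass-sum : ∀ q i φ ψ → sum (λ b → sum λ z →
      (1 * 1) ⊠ ⟪ φ (i , b , z) , φ (i , b , z) ⟫ + (q * q) ⊠ ⟪ ψ (i , b , z) , ψ (i , b , z) ⟫)
      ≈ mass q i φ ψ
    mass-sum q i φ ψ = begin-equality
      _ ≈⟨ trans (sum-cong-≋ {m} λ b → ∑-distrib-+ {d} _ _) (∑-distrib-+ {m} _ _) ⟩
      _ ≈⟨ +-cong (at-⊠ (1 * 1) i φ φ) (at-⊠ (q * q) i ψ ψ) ⟨
      mass q i φ ψ ∎

  at-young⁺ : ∀ q i φ ψ → (2 * (1 * q)) ⊠ at i φ ψ ≲ mass q i φ ψ
  at-young⁺ q i φ ψ = begin
    (2 * (1 * q)) ⊠ at i φ ψ ≈⟨ at-⊠ (2 * (1 * q)) i φ ψ ⟩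
    _ ≲⟨ sum-mono {m} (λ b → sum-mono {d} λ z → young⁺ 1 q _ _) ⟩
    _ ≈⟨ mass-sum q i φ ψ ⟩
    mass q i φ ψ ∎

  at-young⁻ : ∀ q i φ ψ → 0# ≲ (2 * (1 * q)) ⊠ at i φ ψ + mass q i φ ψ
  at-young⁻ q i φ ψ = begin
    0# ≲⟨ sum-nonneg {m} (λ b → sum-nonneg {d} λ z → young⁻ 1 q (φ (i , b , z)) (ψ (i , b , z))) ⟩
    _  ≈⟨ trans (sum-cong-≋ {m} λ b → ∑-distrib-+ {d} _ _) (∑-distrib-+ {m} _ _) ⟩
    _  ≈⟨ +-cong (at-⊠ (2 * (1 * q)) i φ ψ) (sym (mass-sum q i φ ψ)) ⟨
    (2 * (1 * q)) ⊠ at i φ ψ + mass q i φ ψ ∎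

  -- At `j` nothing relates the overlaps before and after the query, so both are estimated:
  -- `at-young⁺` bounds the earlier one above by the mass, `at-young⁻` bounds the later one below by
  -- minus the mass. The query preserves the mass, whence two equal copies of it.
  query-step : ∀ q (F F′ : Flips) j → (∀ i → i ≢ j → ∀ b → flip F i b ≡ flip F′ i b) → ∀ φ ψ →
    (2 * (1 * q)) ⊠ Re⟨ φ , ψ ⟩ ≲
    (2 * (1 * q)) ⊠ Re⟨ φ ∘ onBasis F , ψ ∘ onBasis F′ ⟩ + (mass q j φ ψ + mass q j φ ψ)
  query-step q F F′ j F≗F′ φ ψ = begin
    k ⊠ Re⟨ φ , ψ ⟩                 ≈⟨ sum-⊠ {n} k _ ⟩
    sum (λ i → k ⊠ at i φ ψ)        ≲⟨ sum-mono-at {n} _ _ j _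
                                          (λ i i≢j → ≲-reflexive (×-congʳ k (sym (at-onBasis F F′ i (F≗F′ i i≢j) φ ψ))))
                                          at-j ⟩
    sum (λ i → k ⊠ at i φ′ ψ′) + E+E ≈⟨ +-congʳ (sum-⊠ {n} k _) ⟨
    k ⊠ Re⟨ φ′ , ψ′ ⟩ + E+E         ∎
    where
    k = 2 * (1 * q)
    φ′ = φ ∘ onBasis F
    ψ′ = ψ ∘ onBasis F′
    E = mass q j φ ψ
    E+E = E + E
    mass-onBasis : mass q j φ′ ψ′ ≈ E
    mass-onBasis = +-cong (×-congʳ (1 * 1) (at-onBasis F F j (λ _ → ≡.refl) φ φ))
                          (×-congʳ (q * q) (at-onBasis F′ F′ j (λ _ → ≡.refl) ψ ψ))
    at-j : k ⊠ at j φ ψ ≲ k ⊠ at j φ′ ψ′ + E+E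
    at-j = begin
      k ⊠ at j φ ψ                 ≲⟨ at-young⁺ q j φ ψ ⟩
      E                            ≲⟨ ≲-+ˡ E (at-young⁻ q j φ′ ψ′) ⟩
      (k ⊠ at j φ′ ψ′ + mass q j φ′ ψ′) + E ≈⟨ +-congʳ (+-congˡ mass-onBasis) ⟩
      (k ⊠ at j φ′ ψ′ + E) + E     ≈⟨ +-assoc _ _ _ ⟩
      k ⊠ at j φ′ ψ′ + E+E         ∎

  Re⟨⟩-query : ∀ (F : Flips) φ → Re⟨ φ ∘ onBasis F , φ ∘ onBasis F ⟩ ≈ Re⟨ φ , φ ⟩
  Re⟨⟩-query F φ = sum-cong-≋ {n} λ i → at-onBasis F F i (λ _ → ≡.refl) φ φ

  module Run {Gate : Set} (matrix : Gate → Op) (isometry : ∀ u → Isometry (matrix u)) where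

    step : Flips → St → Gate → St
    step F ψ U = matrix U ▹ query F ▹ ψ

    run : ∀ {T} → Flips → St → Vector Gate T → St
    run F ψ U = Vector.foldl (step F) ψ U

    Re⟨⟩-step : ∀ F F′ φ ψ U →
      Re⟨ step F φ U , step F′ ψ U ⟩ ≈ Re⟨ φ ∘ onBasis F , ψ ∘ onBasis F′ ⟩
    Re⟨⟩-step F F′ φ ψ U = trans
      (Re⟨⟩-isometry {matrix U} (isometry U) (query F ▹ φ) (query F′ ▹ ψ))
      (Re⟨⟩-cong (query-▹ F φ) (query-▹ F′ ψ))

    normalized-step : ∀ F φ U → Re⟨ φ , φ ⟩ ≈ unit → Re⟨ step F φ U , step F φ U ⟩ ≈ unit
    normalized-step F φ U φ-unit = trans (Re⟨⟩-step F F φ φ U) (trans (Re⟨⟩-query F φ) φ-unit)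

    normalized-run : ∀ {T} F φ (U : Vector Gate T) → Re⟨ φ , φ ⟩ ≈ unit →
                     Re⟨ run F φ U , run F φ U ⟩ ≈ unit
    normalized-run {zero}  F φ U φ-unit = φ-unit
    normalized-run {suc T} F φ U φ-unit =
      normalized-run F (step F φ (U zero)) (U ∘ suc) (normalized-step F φ (U zero) φ-unit)

-- Measurement: states with different likely outputs have small overlap

module Measurement (𝒜 : Amplitudes) {n m d : ℕ} (output : Basis n m d → ℕ) where
  open Amplitudes 𝒜
  open InnerProduct 𝒜 n m d
  open ℛ hiding (preorder)
  open OrderedSums reals
  open OrderedBasisSums reals n m d
  open R-Reasoning

  prob : ℕ → St → Carrier
  prob v ψ = ∑ λ x → if ⌊ output x ℕ.≟ v ⌋ then ⟪ ψ x , ψ x ⟫ else 0#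

  -- Outcome v uses 24⟪φ,ψ⟫ ≤ 9⟪φ,φ⟫ + 16⟪ψ,ψ⟫, outcome v′ the same with weights exchanged;
  -- the unused 7 out of 16 is what the probabilities gain.
  distinguish-at : ∀ {v v′} → v ≢ v′ → ∀ (φ ψ : St) x →
    24 ⊠ ⟪ φ x , ψ x ⟫ + (7 ⊠ (if ⌊ output x ℕ.≟ v  ⌋ then ⟪ φ x , φ x ⟫ else 0#) +
                          7 ⊠ (if ⌊ output x ℕ.≟ v′ ⌋ then ⟪ ψ x , ψ x ⟫ else 0#)) ≲
    16 ⊠ ⟪ φ x , φ x ⟫ + 16 ⊠ ⟪ ψ x , ψ x ⟫
  distinguish-at {v} {v′} v≢v′ φ ψ x with output x ℕ.≟ v | output x ℕ.≟ v′
  ... | yes ≡v | yes ≡v′ = contradiction (≡.trans (≡.sym ≡v) ≡v′) v≢v′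
  ... | yes _  | no  _   = begin
    24 ⊠ ⟪ φ x , ψ x ⟫ + (7 ⊠ A + 7 ⊠ 0#)
      ≲⟨ +-mono (young⁺ 3 4 (φ x) (ψ x)) (≲-reflexive (trans (+-congˡ (⊠-zero 7)) (+-identityʳ _))) ⟩
    (9 ⊠ A + 16 ⊠ B) + 7 ⊠ A
      ≈⟨ trans (+-assoc _ _ _) (trans (+-congˡ (+-comm _ _)) (sym (+-assoc _ _ _))) ⟩
    (9 ⊠ A + 7 ⊠ A) + 16 ⊠ B
      ≈⟨ +-congʳ (×-homo-+ A 9 7) ⟨
    16 ⊠ A + 16 ⊠ B ∎
    where A = ⟪ φ x , φ x ⟫
          B = ⟪ ψ x , ψ x ⟫
  ... | no  _  | yes _   = begin
    24 ⊠ ⟪ φ x , ψ x ⟫ + (7 ⊠ 0# + 7 ⊠ B)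
      ≲⟨ +-mono (young⁺ 4 3 (φ x) (ψ x)) (≲-reflexive (trans (+-congʳ (⊠-zero 7)) (+-identityˡ _))) ⟩
    (16 ⊠ A + 9 ⊠ B) + 7 ⊠ B
      ≈⟨ trans (+-assoc _ _ _) (+-congˡ (sym (×-homo-+ B 9 7))) ⟩
    16 ⊠ A + 16 ⊠ B ∎
    where A = ⟪ φ x , φ x ⟫
          B = ⟪ ψ x , ψ x ⟫
  ... | no  _  | no  _   = begin
    24 ⊠ ⟪ φ x , ψ x ⟫ + (7 ⊠ 0# + 7 ⊠ 0#)
      ≲⟨ +-mono (young⁺ 4 3 (φ x) (ψ x))
                (+-mono (≲-reflexive (⊠-zero 7))
                        (⊠-mono 7 (⟪⟫-nonneg (ψ x)))) ⟩
    (16 ⊠ A + 9 ⊠ B) + (0# + 7 ⊠ B)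
      ≈⟨ trans (+-congˡ (+-identityˡ _)) (trans (+-assoc _ _ _) (+-congˡ (sym (×-homo-+ B 9 7)))) ⟩
    16 ⊠ A + 16 ⊠ B ∎
    where A = ⟪ φ x , φ x ⟫
          B = ⟪ ψ x , ψ x ⟫

  -- The factor 3 clears the denominator of 2/3: 72 = 3·24, 96 = 3·(16 + 16), and each probability
  -- gains 7·2 = 14. On outcome `v` the masses of φ and ψ are 2/3 and 1/3 in the extreme case, where
  -- the best weight ratio in Young's inequality is √2; the ratio 4/3 is close enough to keep the
  -- overlap below 1.
  distinguish : ∀ {v v′} → v ≢ v′ → ∀ φ ψ →
    Re⟨ φ , φ ⟩ ≈ unit → Re⟨ ψ , ψ ⟩ ≈ unit →
    2 ⊠ unit ≲ 3 ⊠ prob v φ → 2 ⊠ unit ≲ 3 ⊠ prob v′ ψ →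
    72 ⊠ Re⟨ φ , ψ ⟩ + 28 ⊠ unit ≲ 96 ⊠ unit
  distinguish {v} {v′} v≢v′ φ ψ φ-unit ψ-unit φ-v ψ-v′ = begin
    72 ⊠ Re⟨ φ , ψ ⟩ + 28 ⊠ unit
      ≈⟨ +-cong (sym (×-assocˡ _ 3 24)) (×-homo-+ unit 14 14) ⟩
    3 ⊠ 24 ⊠ Re⟨ φ , ψ ⟩ + (14 ⊠ unit + 14 ⊠ unit)
      ≲⟨ +-monoʳ _ (+-mono (scaled φ-v) (scaled ψ-v′)) ⟩
    3 ⊠ 24 ⊠ Re⟨ φ , ψ ⟩ + (3 ⊠ 7 ⊠ prob v φ + 3 ⊠ 7 ⊠ prob v′ ψ)
      ≈⟨ trans (×-distrib-+ _ _ 3) (+-congˡ (×-distrib-+ _ _ 3)) ⟨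
    3 ⊠ (24 ⊠ Re⟨ φ , ψ ⟩ + (7 ⊠ prob v φ + 7 ⊠ prob v′ ψ))
      ≲⟨ ⊠-mono 3 summed ⟩
    3 ⊠ (16 ⊠ Re⟨ φ , φ ⟩ + 16 ⊠ Re⟨ ψ , ψ ⟩)
      ≈⟨ ×-congʳ 3 (+-cong (×-congʳ 16 φ-unit) (×-congʳ 16 ψ-unit)) ⟩
    3 ⊠ (16 ⊠ unit + 16 ⊠ unit)
      ≈⟨ trans (×-congʳ 3 (sym (×-homo-+ unit 16 16))) (×-assocˡ unit 3 32) ⟩
    96 ⊠ unit ∎
    where
    scaled : ∀ {x} → 2 ⊠ unit ≲ 3 ⊠ x → 14 ⊠ unit ≲ 3 ⊠ 7 ⊠ x
    scaled {x} 2≲3x = begin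
      14 ⊠ unit     ≈⟨ ×-assocˡ unit 7 2 ⟨
      7 ⊠ 2 ⊠ unit  ≲⟨ ⊠-mono 7 2≲3x ⟩
      7 ⊠ 3 ⊠ x     ≈⟨ trans (×-assocˡ x 7 3) (sym (×-assocˡ x 3 7)) ⟩
      3 ⊠ 7 ⊠ x     ∎
    summed : 24 ⊠ Re⟨ φ , ψ ⟩ + (7 ⊠ prob v φ + 7 ⊠ prob v′ ψ) ≲
             16 ⊠ Re⟨ φ , φ ⟩ + 16 ⊠ Re⟨ ψ , ψ ⟩
    summed = begin
      24 ⊠ Re⟨ φ , ψ ⟩ + (7 ⊠ prob v φ + 7 ⊠ prob v′ ψ)
        ≈⟨ +-cong (∑-⊠ 24 _) (+-cong (∑-⊠ 7 _) (∑-⊠ 7 _)) ⟩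
      _ ≈⟨ trans (∑-homo-+ _ _) (+-congˡ (∑-homo-+ _ _)) ⟨
      _ ≲⟨ ∑-mono (distinguish-at v≢v′ φ ψ) ⟩
      _ ≈⟨ ∑-homo-+ _ _ ⟩
      _ ≈⟨ +-cong (∑-⊠ 16 _) (∑-⊠ 16 _) ⟨
      16 ⊠ Re⟨ φ , φ ⟩ + 16 ⊠ Re⟨ ψ , ψ ⟩ ∎

-- The hypothesis is what tradeoff yields; q = 36T makes its T·N terms balance.
N≤[36T]² : ∀ N T → (∀ q →
    36 * (2 * (1 * q) * N) ℕ.+ q * (N * 28) ≤
    q * (N * 96) ℕ.+ 36 * (T * ((1 * 1 * N ℕ.+ q * q) ℕ.+ (1 * 1 * N ℕ.+ q * q)))) →
  N ≤ (36 * T) * (36 * T)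
-- Here `36 * T` is 0 and would make the hypothesis trivial; `q = 1` leaves `4 * N ≤ 0`.
N≤[36T]² N zero tradeoff = ℕ.*-cancelˡ-≤ 4 (ℕ.+-cancelˡ-≤ (96 * N) (4 * N) (4 * 0)
  (≡.subst₂ _≤_ (lhs N) (rhs N) (tradeoff 1)))
  where
  lhs : ∀ N → 36 * (2 * (1 * 1) * N) ℕ.+ 1 * (N * 28) ≡ 96 * N ℕ.+ 4 * N
  lhs = solve-∀
  rhs : ∀ N → 1 * (N * 96) ℕ.+ 0 ≡ 96 * N ℕ.+ 0
  rhs = solve-∀
N≤[36T]² N T@(suc _) tradeoff = ℕ.*-cancelˡ-≤ (72 * T)
  (ℕ.+-cancelˡ-≤ (q * (N * 96) ℕ.+ 72 * T * N) _ _ (≡.subst₂ _≤_ (lhs N T) (rhs N T) (tradeoff q)))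
  where
  q = 36 * T
  lhs : ∀ N T → 36 * (2 * (1 * (36 * T)) * N) ℕ.+ 36 * T * (N * 28) ≡
                (36 * T * (N * 96) ℕ.+ 72 * T * N) ℕ.+ 72 * T * N
  lhs = solve-∀
  rhs : ∀ N T →
    36 * T * (N * 96) ℕ.+ 36 * (T * ((1 * 1 * N ℕ.+ 36 * T * (36 * T)) ℕ.+ (1 * 1 * N ℕ.+ 36 * T * (36 * T)))) ≡
    (36 * T * (N * 96) ℕ.+ 72 * T * N) ℕ.+ 72 * T * (36 * T * (36 * T))
  rhs = solve-∀

-- Summation over the marked positions

module Search (𝒜 : Amplitudes) (N m d : ℕ) where
  private
    n : ℕ
    n = suc (suc N)
  open Amplitudes 𝒜
  open InnerProduct 𝒜 n m d
  open Hybrid 𝒜 n m d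
  open Flips
  open ℛ hiding (preorder)
  open OrderedSums reals
  open R-Reasoning

  -- The end positions are excluded because for odd n a square of shift ⌊n/2⌋ can avoid either of
  -- them.
  marked : Fin N → Fin n
  marked j = suc (inject₁ j)

  budget : ℕ → Carrier
  budget q = (1 * 1) ⊠ (N ⊠ unit) + (q * q) ⊠ unit

  -- The states `φ j` belong to different inputs, so their masses at the marked positions are
  -- bounded only one by one, which gives N. The masses of `ψ` are parts of a single unit vector.
  -- This asymmetry is why only the second kind can afford the weight q².
  sum-mass : ∀ q (φ : Fin N → St) ψ → (∀ j → Re⟨ φ j , φ j ⟩ ≈ unit) → Re⟨ ψ , ψ ⟩ ≈ unit →
             sum (λ j → mass q (marked j) (φ j) ψ) ≲ budget q
  sum-mass q φ ψ φ-unit ψ-unit = begin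
    sum (λ j → mass q (marked j) (φ j) ψ)
      ≈⟨ ∑-distrib-+ {N} _ _ ⟩
    sum (λ j → (1 * 1) ⊠ at (marked j) (φ j) (φ j)) + sum (λ j → (q * q) ⊠ at (marked j) ψ ψ)
      ≈⟨ +-cong (sum-⊠ {N} (1 * 1) _) (sum-⊠ {N} (q * q) _) ⟨
    (1 * 1) ⊠ sum (λ j → at (marked j) (φ j) (φ j)) + (q * q) ⊠ sum (λ j → at (marked j) ψ ψ)
      ≲⟨ +-mono (⊠-mono (1 * 1) (sum-mono {N} at-marked))
                (⊠-mono (q * q) (sum-interior {N} (λ i → at i ψ ψ) (λ i → at-nonneg i ψ))) ⟩
    (1 * 1) ⊠ sum (λ (j : Fin N) → unit) + (q * q) ⊠ Re⟨ ψ , ψ ⟩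
      ≈⟨ +-cong (×-congʳ (1 * 1) (sum-replicate N)) (×-congʳ (q * q) ψ-unit) ⟩
    budget q ∎
    where
    at-marked : ∀ j → at (marked j) (φ j) (φ j) ≲ unit
    at-marked j = begin
      at (marked j) (φ j) (φ j) ≲⟨ term≲sum {n} (λ i → at-nonneg i (φ j)) (marked j) ⟩
      Re⟨ φ j , φ j ⟩           ≈⟨ φ-unit j ⟩
      unit                      ∎

  module _ {Gate : Set} (matrix : Gate → Op) (isometry : ∀ u → Isometry (matrix u)) where
    open Run matrix isometry

    -- Arbitrary unit states `φ j` are allowed, although all runs start from one state: they may
    -- separate at the first query, and the induction on the gates continues from the separated
    -- states.
    hybrid : ∀ q (F : Fin N → Flips) F₀ →
      (∀ j i → i ≢ marked j → ∀ b → flip (F j) i b ≡ flip F₀ i b) →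
      ∀ {T} (U : Vector Gate T) (φ : Fin N → St) ψ →
      (∀ j → Re⟨ φ j , φ j ⟩ ≈ unit) → Re⟨ ψ , ψ ⟩ ≈ unit →
      (2 * (1 * q)) ⊠ sum (λ j → Re⟨ φ j , ψ ⟩) ≲
      (2 * (1 * q)) ⊠ sum (λ j → Re⟨ run (F j) (φ j) U , run F₀ ψ U ⟩) + T ⊠ (budget q + budget q)
    hybrid q F F₀ agree {zero}  U φ ψ φ-unit ψ-unit = ≲-reflexive (sym (+-identityʳ _))
    hybrid q F F₀ agree {suc T} U φ ψ φ-unit ψ-unit = begin
      k ⊠ sum (λ j → Re⟨ φ j , ψ ⟩)
        ≈⟨ sum-⊠ {N} k _ ⟩
      sum (λ j → k ⊠ Re⟨ φ j , ψ ⟩)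
        ≲⟨ sum-mono {N} (λ j → query-step q (F j) F₀ (marked j) (agree j) (φ j) ψ) ⟩
      sum (λ j → k ⊠ Re⟨ φ j ∘ onBasis (F j) , ψ ∘ onBasis F₀ ⟩ + (E j + E j))
        ≈⟨ sum-cong-≋ {N} (λ j → +-congʳ (×-congʳ k (Re⟨⟩-step (F j) F₀ (φ j) ψ (U zero)))) ⟨
      sum (λ j → k ⊠ Re⟨ φ′ j , ψ′ ⟩ + (E j + E j))
        ≈⟨ trans (∑-distrib-+ {N} _ _) (+-congˡ (∑-distrib-+ {N} _ _)) ⟩
      sum (λ j → k ⊠ Re⟨ φ′ j , ψ′ ⟩) + (sum E + sum E)
        ≈⟨ +-congʳ (sum-⊠ {N} k _) ⟨
      k ⊠ sum (λ j → Re⟨ φ′ j , ψ′ ⟩) + (sum E + sum E)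
        ≲⟨ +-mono (hybrid q F F₀ agree (U ∘ suc) φ′ ψ′
                     (λ j → normalized-step (F j) (φ j) (U zero) (φ-unit j))
                     (normalized-step F₀ ψ (U zero) ψ-unit))
                  (+-mono (sum-mass q φ ψ φ-unit ψ-unit) (sum-mass q φ ψ φ-unit ψ-unit)) ⟩
      (Γ + T ⊠ B) + B
        ≈⟨ trans (+-assoc _ _ _) (+-congˡ (+-comm _ _)) ⟩
      Γ + suc T ⊠ B ∎
      where
      k = 2 * (1 * q)
      B = budget q + budget q
      E = λ j → mass q (marked j) (φ j) ψ
      φ′ = λ j → step (F j) (φ j) (U zero)
      ψ′ = step F₀ ψ (U zero)
      Γ = k ⊠ sum (λ j → Re⟨ run (F j) (φ′ j) (U ∘ suc) , run F₀ ψ′ (U ∘ suc) ⟩)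

    module _ (output : Basis n m d → ℕ) where
      open Measurement 𝒜 output

      -- `hybrid` bounds the initial overlaps by `2q` times the final sum `Γ`, while `distinguish`
      -- bounds `72 ⊠ Γ`. Scaling by 36 and by `q` gives both the term `72q` times `Γ`, so one
      -- inequality can be inserted into the other.
      tradeoff : ∀ q (F : Fin N → Flips) F₀ →
        (∀ j i → i ≢ marked j → ∀ b → flip (F j) i b ≡ flip F₀ i b) →
        ∀ {T} (U : Vector Gate T) ψ → Re⟨ ψ , ψ ⟩ ≈ unit →
        (v : Fin N → ℕ) (v₀ : ℕ) → (∀ j → v j ≢ v₀) →
        (∀ j → 2 ⊠ unit ≲ 3 ⊠ prob (v j) (run (F j) ψ U)) →
        2 ⊠ unit ≲ 3 ⊠ prob v₀ (run F₀ ψ U) →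
        (36 * (2 * (1 * q) * N) ℕ.+ q * (N * 28)) ⊠ unit ≲
        (q * (N * 96) ℕ.+ 36 * (T * ((1 * 1 * N ℕ.+ q * q) ℕ.+ (1 * 1 * N ℕ.+ q * q)))) ⊠ unit
      tradeoff q F F₀ agree {T} U ψ ψ-unit v v₀ v≢v₀ correct correct₀ = begin
        (36 * (k * N) ℕ.+ q * (N * 28)) ⊠ unit
          ≈⟨ ×-homo-+ unit (36 * (k * N)) _ ⟩
        (36 * (k * N)) ⊠ unit + (q * (N * 28)) ⊠ unit
          ≈⟨ +-cong (trans (×-congʳ 36 (×-assocˡ unit k N)) (×-assocˡ unit 36 (k * N)))
                    (trans (×-congʳ q (×-assocˡ unit N 28)) (×-assocˡ unit q (N * 28))) ⟨
        36 ⊠ k ⊠ N ⊠ unit + q ⊠ N ⊠ 28 ⊠ unit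
          ≲⟨ +-monoˡ _ (⊠-mono 36 initially) ⟩
        36 ⊠ (k ⊠ Γ + T ⊠ (B + B)) + q ⊠ N ⊠ 28 ⊠ unit
          ≈⟨ +-congʳ (×-distrib-+ _ _ 36) ⟩
        (36 ⊠ k ⊠ Γ + 36 ⊠ T ⊠ (B + B)) + q ⊠ N ⊠ 28 ⊠ unit
          ≈⟨ trans (+-assoc _ _ _) (trans (+-congˡ (+-comm _ _)) (sym (+-assoc _ _ _))) ⟩
        (36 ⊠ k ⊠ Γ + q ⊠ N ⊠ 28 ⊠ unit) + 36 ⊠ T ⊠ (B + B)
          ≈⟨ +-congʳ (+-congʳ 36kΓ) ⟩
        (q ⊠ 72 ⊠ Γ + q ⊠ N ⊠ 28 ⊠ unit) + 36 ⊠ T ⊠ (B + B)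
          ≈⟨ +-congʳ (×-distrib-+ _ _ q) ⟨
        q ⊠ (72 ⊠ Γ + N ⊠ 28 ⊠ unit) + 36 ⊠ T ⊠ (B + B)
          ≲⟨ +-monoˡ _ (⊠-mono q finally) ⟩
        q ⊠ N ⊠ 96 ⊠ unit + 36 ⊠ T ⊠ (B + B)
          ≈⟨ +-cong (trans (×-congʳ q (×-assocˡ unit N 96)) (×-assocˡ unit q (N * 96)))
                    (trans (×-congʳ 36 (trans (×-congʳ T B+B) (×-assocˡ unit T (b ℕ.+ b))))
                           (×-assocˡ unit 36 (T * (b ℕ.+ b)))) ⟩
        (q * (N * 96)) ⊠ unit + (36 * (T * (b ℕ.+ b))) ⊠ unit
          ≈⟨ ×-homo-+ unit (q * (N * 96)) _ ⟨
        (q * (N * 96) ℕ.+ 36 * (T * (b ℕ.+ b))) ⊠ unit ∎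
        where
        k = 2 * (1 * q)
        b = 1 * 1 * N ℕ.+ q * q
        B = budget q
        Γ = sum λ j → Re⟨ run (F j) ψ U , run F₀ ψ U ⟩
        36kΓ : 36 ⊠ k ⊠ Γ ≈ q ⊠ 72 ⊠ Γ
        36kΓ = trans (×-assocˡ Γ 36 k) (trans (×-congˡ (36k≡q72 q)) (sym (×-assocˡ Γ q 72)))
          where
          36k≡q72 : ∀ q → 36 * (2 * (1 * q)) ≡ q * 72
          36k≡q72 = solve-∀
        B≈ : B ≈ b ⊠ unit
        B≈ = trans (+-congʳ (×-assocˡ unit (1 * 1) N)) (sym (×-homo-+ unit (1 * 1 * N) (q * q)))
        B+B : B + B ≈ (b ℕ.+ b) ⊠ unit
        B+B = trans (+-cong B≈ B≈) (sym (×-homo-+ unit b b))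
        initially : k ⊠ N ⊠ unit ≲ k ⊠ Γ + T ⊠ (B + B)
        initially = begin
          k ⊠ N ⊠ unit                    ≈⟨ ×-congʳ k (sum-replicate N) ⟨
          k ⊠ sum (λ (j : Fin N) → unit)  ≈⟨ ×-congʳ k (sum-cong-≋ {N} λ _ → ψ-unit) ⟨
          k ⊠ sum (λ (j : Fin N) → Re⟨ ψ , ψ ⟩) ≲⟨ hybrid q F F₀ agree U (λ _ → ψ) ψ (λ _ → ψ-unit) ψ-unit ⟩
          k ⊠ Γ + T ⊠ (B + B)             ∎
        finally : 72 ⊠ Γ + N ⊠ 28 ⊠ unit ≲ N ⊠ 96 ⊠ unit
        finally = begin
          72 ⊠ Γ + N ⊠ 28 ⊠ unit
            ≈⟨ +-cong (sum-⊠ {N} 72 _) (sym (sum-replicate N)) ⟩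
          _ ≈⟨ ∑-distrib-+ {N} _ _ ⟨
          sum (λ j → 72 ⊠ Re⟨ run (F j) ψ U , run F₀ ψ U ⟩ + 28 ⊠ unit)
            ≲⟨ sum-mono {N} (λ j → distinguish (v≢v₀ j) (run (F j) ψ U) (run F₀ ψ U)
                 (normalized-run (F j) ψ U ψ-unit) (normalized-run F₀ ψ U ψ-unit)
                 (correct j) correct₀) ⟩
          sum (λ (j : Fin N) → 96 ⊠ unit)
            ≈⟨ sum-replicate N ⟩
          N ⊠ 96 ⊠ unit ∎

      search-bound : (∀ a b → a ⊠ unit ≲ b ⊠ unit → a ≤ b) → (F : Fin N → Flips) (F₀ : Flips) →
        (∀ j i → i ≢ marked j → ∀ b → flip (F j) i b ≡ flip F₀ i b) →
        ∀ {T} (U : Vector Gate T) ψ → Re⟨ ψ , ψ ⟩ ≈ unit →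
        (v : Fin N → ℕ) (v₀ : ℕ) → (∀ j → v j ≢ v₀) →
        (∀ j → 2 ⊠ unit ≲ 3 ⊠ prob (v j) (run (F j) ψ U)) →
        2 ⊠ unit ≲ 3 ⊠ prob v₀ (run F₀ ψ U) →
        N ≤ (36 * T) * (36 * T)
      search-bound reflects F F₀ agree {T} U ψ ψ-unit v v₀ v≢v₀ correct correct₀ =
        N≤[36T]² N T λ q → reflects _ _ (tradeoff q F F₀ agree U ψ ψ-unit v v₀ v≢v₀ correct correct₀)

-- Real and complex numbers

module _ where
  open ℚ.≤-Reasoning

  p≤∣p∣ : ∀ p → p ℚ.≤ ℚ.∣ p ∣
  p≤∣p∣ p with ℚ.≤-total 0ℚ p
  ... | inj₁ 0≤p = ℚ.≤-reflexive (≡.sym (ℚ.0≤p⇒∣p∣≡p 0≤p))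
  ... | inj₂ p≤0 = ℚ.≤-trans p≤0 (ℚ.0≤∣p∣ p)

  0≤p*p : ∀ p → 0ℚ ℚ.≤ p ℚ.* p
  0≤p*p p = ≡.subst (0ℚ ℚ.≤_) ∣p*p∣≡p*p (ℚ.0≤∣p∣ (p ℚ.* p))
    where
    ∣p*p∣≡p*p : ℚ.∣ p ℚ.* p ∣ ≡ p ℚ.* p
    ∣p*p∣≡p*p with ℚ.∣p∣≡p∨∣p∣≡-p p
    ... | inj₁ ∣p∣≡p  = ≡.trans (ℚ.∣p*q∣≡∣p∣*∣q∣ p p) (≡.cong₂ ℚ._*_ ∣p∣≡p ∣p∣≡p)
    ... | inj₂ ∣p∣≡-p = ≡.trans (ℚ.∣p*q∣≡∣p∣*∣q∣ p p)
      (≡.trans (≡.cong₂ ℚ._*_ ∣p∣≡-p ∣p∣≡-p) (solve 1 (λ p → :- p :* :- p := p :* p) ≡.refl p))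
      where open +-*-Solver

  p≤p+q : ∀ p {q} → 0ℚ ℚ.≤ q → p ℚ.≤ p ℚ.+ q
  p≤p+q p {q} 0≤q = begin
    p         ≡⟨ ℚ.+-identityʳ p ⟨
    p ℚ.+ 0ℚ  ≤⟨ ℚ.+-monoʳ-≤ p 0≤q ⟩
    p ℚ.+ q   ∎

  0<½*ε : ∀ {ε} → 0ℚ ℚ.< ε → 0ℚ ℚ.< ½ ℚ.* ε
  0<½*ε {ε} ε>0 = ≡.subst (ℚ._< ½ ℚ.* ε) (ℚ.*-zeroʳ ½) (ℚ.*-monoʳ-<-pos ½ ε>0)

  ½*ε+½*ε : ∀ ε → ½ ℚ.* ε ℚ.+ ½ ℚ.* ε ≡ ε
  ½*ε+½*ε ε = ≡.trans (≡.sym (ℚ.*-distribʳ-+ ε ½ ½)) (ℚ.*-identityˡ ε)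

  0<1ℚ : 0ℚ ℚ.< 1ℚ
  0<1ℚ = ℚ.positive⁻¹ 1ℚ

Eventually-× : ∀ {P Q : ℕ → Set} → Eventually P → Eventually Q → Eventually (λ n → P n × Q n)
Eventually-× (M , p) (N , q) = M ℕ.⊔ N , λ n n≥ →
  p n (ℕ.m⊔n≤o⇒m≤o M N n≥) , q n (ℕ.m⊔n≤o⇒n≤o M N n≥)

Eventually-map : ∀ {P Q : ℕ → Set} → (∀ n → P n → Q n) → Eventually P → Eventually Q
Eventually-map f (N , p) = N , λ n n≥ → f n (p n n≥)

-- `x ≈ʳ y` is `Null` of the pointwise difference by definition, so the congruence laws amount to
-- null sequences forming an ideal among Cauchy sequences.
Null : (ℕ → ℚ) → Set
Null x = ∀ ε → 0ℚ ℚ.< ε → Eventually (λ n → ℚ.∣ x n ∣ ℚ.≤ ε)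

Null-≗ : ∀ {x y} → (∀ n → x n ≡ y n) → Null x → Null y
Null-≗ x≗y nx ε ε>0 =
  Eventually-map (λ n → ≡.subst (λ q → ℚ.∣ q ∣ ℚ.≤ ε) (x≗y n)) (nx ε ε>0)

Null-0 : Null (λ _ → 0ℚ)
Null-0 ε ε>0 = 0 , λ _ _ → ℚ.<⇒≤ ε>0

Null-- : ∀ {x} → Null x → Null (λ n → ℚ.- x n)
Null-- {x} nx ε ε>0 =
  Eventually-map (λ n → ≡.subst (ℚ._≤ ε) (≡.sym (ℚ.∣-p∣≡∣p∣ (x n)))) (nx ε ε>0)

Null-+ : ∀ {x y} → Null x → Null y → Null (λ n → x n ℚ.+ y n)
Null-+ {x} {y} nx ny ε ε>0 =
  Eventually-map sum-small (Eventually-× (nx _ (0<½*ε ε>0)) (ny _ (0<½*ε ε>0)))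
  where
  sum-small : ∀ n → ℚ.∣ x n ∣ ℚ.≤ ½ ℚ.* ε × ℚ.∣ y n ∣ ℚ.≤ ½ ℚ.* ε → ℚ.∣ x n ℚ.+ y n ∣ ℚ.≤ ε
  sum-small n (x≤ , y≤) = begin
    ℚ.∣ x n ℚ.+ y n ∣           ≤⟨ ℚ.∣p+q∣≤∣p∣+∣q∣ (x n) (y n) ⟩
    ℚ.∣ x n ∣ ℚ.+ ℚ.∣ y n ∣     ≤⟨ ℚ.+-mono-≤ x≤ y≤ ⟩
    ½ ℚ.* ε ℚ.+ ½ ℚ.* ε         ≡⟨ ½*ε+½*ε ε ⟩
    ε                           ∎
    where open ℚ.≤-Reasoning

eventually-bounded : (y : ℝ) → ∃[ B ] (0ℚ ℚ.< B × Eventually (λ n → ℚ.∣ seq y n ∣ ℚ.≤ B))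
eventually-bounded y =
  let N , close = cauchy y 1ℚ 0<1ℚ
  in 1ℚ ℚ.+ ℚ.∣ seq y N ∣ , ℚ.+-mono-<-≤ 0<1ℚ (ℚ.0≤∣p∣ (seq y N)) , N , λ n n≥ → begin
    ℚ.∣ seq y n ∣
      ≡⟨ ≡.cong ℚ.∣_∣ (solve 2 (λ a b → a := (a :- b) :+ b) ≡.refl (seq y n) (seq y N)) ⟩
    ℚ.∣ (seq y n ℚ.- seq y N) ℚ.+ seq y N ∣
      ≤⟨ ℚ.∣p+q∣≤∣p∣+∣q∣ (seq y n ℚ.- seq y N) (seq y N) ⟩
    ℚ.∣ seq y n ℚ.- seq y N ∣ ℚ.+ ℚ.∣ seq y N ∣
      ≤⟨ ℚ.+-monoˡ-≤ ℚ.∣ seq y N ∣ (close n N n≥ ℕ.≤-refl) ⟩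
    1ℚ ℚ.+ ℚ.∣ seq y N ∣ ∎
  where
  open ℚ.≤-Reasoning
  open +-*-Solver

Null-* : ∀ {x} → Null x → (y : ℝ) → Null (λ n → x n ℚ.* seq y n)
Null-* {x} nx y ε ε>0 = Eventually-map product-small
  (Eventually-× (nx (ε ℚ.* B⁻¹) 0<ε/B) (proj₂ (proj₂ bounded-y)))
  where
  open ℚ.≤-Reasoning
  bounded-y = eventually-bounded y
  B = proj₁ bounded-y
  instance
    B-pos : ℚ.Positive B
    B-pos = ℚ.positive (proj₁ (proj₂ bounded-y))
    B-nonZero : ℚ.NonZero B
    B-nonZero = ℚ.pos⇒nonZero B
  B⁻¹ = ℚ.1/ B
  instance
    B⁻¹-pos : ℚ.Positive B⁻¹
    B⁻¹-pos = ℚ.1/pos⇒pos B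
    B-nonNeg : ℚ.NonNegative B
    B-nonNeg = ℚ.pos⇒nonNeg B
  0<ε/B : 0ℚ ℚ.< ε ℚ.* B⁻¹
  0<ε/B = ≡.subst (ℚ._< ε ℚ.* B⁻¹) (ℚ.*-zeroˡ B⁻¹) (ℚ.*-monoˡ-<-pos B⁻¹ ε>0)
  product-small : ∀ n → ℚ.∣ x n ∣ ℚ.≤ ε ℚ.* B⁻¹ × ℚ.∣ seq y n ∣ ℚ.≤ B → ℚ.∣ x n ℚ.* seq y n ∣ ℚ.≤ ε
  product-small n (x≤ , y≤) = begin
    ℚ.∣ x n ℚ.* seq y n ∣         ≡⟨ ℚ.∣p*q∣≡∣p∣*∣q∣ (x n) (seq y n) ⟩
    ℚ.∣ x n ∣ ℚ.* ℚ.∣ seq y n ∣   ≤⟨ ℚ.*-monoˡ-≤-nonNeg ℚ.∣ x n ∣ {{ℚ.∣-∣-nonNeg (x n)}} y≤ ⟩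
    ℚ.∣ x n ∣ ℚ.* B               ≤⟨ ℚ.*-monoʳ-≤-nonNeg B x≤ ⟩
    ε ℚ.* B⁻¹ ℚ.* B               ≡⟨ ℚ.*-assoc ε B⁻¹ B ⟩
    ε ℚ.* (B⁻¹ ℚ.* B)             ≡⟨ ≡.cong (ε ℚ.*_) (ℚ.*-inverseˡ B) ⟩
    ε ℚ.* 1ℚ                      ≡⟨ ℚ.*-identityʳ ε ⟩
    ε                             ∎

module _ where
  open +-*-Solver

  ≈ʳ-pointwise : ∀ x y → (∀ n → seq x n ≡ seq y n) → x ≈ʳ y
  ≈ʳ-pointwise x y x≗y = Null-≗ {λ _ → 0ℚ}
    (λ n → ≡.trans (≡.sym (ℚ.+-inverseʳ (seq x n))) (≡.cong (λ q → seq x n ℚ.- q) (x≗y n))) Null-0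

  ≈ʳ-sym : ∀ x y → x ≈ʳ y → y ≈ʳ x
  ≈ʳ-sym x y x≈y = Null-≗ {λ n → ℚ.- (seq x n ℚ.- seq y n)}
    (λ n → solve 2 (λ a b → :- (a :- b) := b :- a) ≡.refl (seq x n) (seq y n))
    (Null-- {λ n → seq x n ℚ.- seq y n} x≈y)

  ≈ʳ-trans : ∀ x y z → x ≈ʳ y → y ≈ʳ z → x ≈ʳ z
  ≈ʳ-trans x y z x≈y y≈z = Null-≗ {λ n → (seq x n ℚ.- seq y n) ℚ.+ (seq y n ℚ.- seq z n)}
    (λ n → solve 3 (λ a b c → (a :- b) :+ (b :- c) := a :- c) ≡.refl (seq x n) (seq y n) (seq z n))
    (Null-+ {λ n → seq x n ℚ.- seq y n} {λ n → seq y n ℚ.- seq z n} x≈y y≈z)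

  +ʳ-cong : ∀ x x′ y y′ → x ≈ʳ x′ → y ≈ʳ y′ → x +ʳ y ≈ʳ x′ +ʳ y′
  +ʳ-cong x x′ y y′ x≈x′ y≈y′ = Null-≗
    {λ n → (seq x n ℚ.- seq x′ n) ℚ.+ (seq y n ℚ.- seq y′ n)}
    (λ n → solve 4 (λ a b c d → (a :- b) :+ (c :- d) := (a :+ c) :- (b :+ d)) ≡.refl
             (seq x n) (seq x′ n) (seq y n) (seq y′ n))
    (Null-+ {λ n → seq x n ℚ.- seq x′ n} {λ n → seq y n ℚ.- seq y′ n} x≈x′ y≈y′)

  -ʳ-cong : ∀ x y → x ≈ʳ y → -ʳ x ≈ʳ -ʳ y
  -ʳ-cong x y x≈y = Null-≗ {λ n → ℚ.- (seq x n ℚ.- seq y n)}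
    (λ n → solve 2 (λ a b → :- (a :- b) := :- a :- :- b) ≡.refl (seq x n) (seq y n))
    (Null-- {λ n → seq x n ℚ.- seq y n} x≈y)

  *ʳ-cong : ∀ x x′ y y′ → x ≈ʳ x′ → y ≈ʳ y′ → x *ʳ y ≈ʳ x′ *ʳ y′
  *ʳ-cong x x′ y y′ x≈x′ y≈y′ = Null-≗
    {λ n → (seq x n ℚ.- seq x′ n) ℚ.* seq y n ℚ.+ (seq y n ℚ.- seq y′ n) ℚ.* seq x′ n}
    (λ n → solve 4 (λ a b c d → (a :- b) :* c :+ (c :- d) :* b := (a :* c) :- (b :* d)) ≡.refl
             (seq x n) (seq x′ n) (seq y n) (seq y′ n))
    (Null-+ {λ n → (seq x n ℚ.- seq x′ n) ℚ.* seq y n} {λ n → (seq y n ℚ.- seq y′ n) ℚ.* seq x′ n}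
      (Null-* {λ n → seq x n ℚ.- seq x′ n} x≈x′ y) (Null-* {λ n → seq y n ℚ.- seq y′ n} y≈y′ x′))

≤ʳ-pointwise : ∀ x y → (∀ n → seq x n ℚ.≤ seq y n) → x ≤ʳ y
≤ʳ-pointwise x y x≤y ε ε>0 = 0 , λ n _ → ℚ.≤-trans (x≤y n) (p≤p+q (seq y n) (ℚ.<⇒≤ ε>0))

≤ʳ-reflexive : ∀ x y → x ≈ʳ y → x ≤ʳ y
≤ʳ-reflexive x y x≈y ε ε>0 = Eventually-map near (x≈y ε ε>0)
  where
  open ℚ.≤-Reasoning
  open +-*-Solver
  near : ∀ n → ℚ.∣ seq x n ℚ.- seq y n ∣ ℚ.≤ ε → seq x n ℚ.≤ seq y n ℚ.+ ε
  near n x-y≤ε = begin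
    seq x n                             ≡⟨ solve 2 (λ a b → a := b :+ (a :- b)) ≡.refl (seq x n) (seq y n) ⟩
    seq y n ℚ.+ (seq x n ℚ.- seq y n)   ≤⟨ ℚ.+-monoʳ-≤ (seq y n) (ℚ.≤-trans (p≤∣p∣ _) x-y≤ε) ⟩
    seq y n ℚ.+ ε                       ∎

≤ʳ-trans : ∀ x y z → x ≤ʳ y → y ≤ʳ z → x ≤ʳ z
≤ʳ-trans x y z x≤y y≤z ε ε>0 =
  Eventually-map chain (Eventually-× (x≤y _ (0<½*ε ε>0)) (y≤z _ (0<½*ε ε>0)))
  where
  open ℚ.≤-Reasoning
  chain : ∀ n → seq x n ℚ.≤ seq y n ℚ.+ ½ ℚ.* ε × seq y n ℚ.≤ seq z n ℚ.+ ½ ℚ.* ε →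
          seq x n ℚ.≤ seq z n ℚ.+ ε
  chain n (x≤ , y≤) = begin
    seq x n                                   ≤⟨ x≤ ⟩
    seq y n ℚ.+ ½ ℚ.* ε                       ≤⟨ ℚ.+-monoˡ-≤ _ y≤ ⟩
    seq z n ℚ.+ ½ ℚ.* ε ℚ.+ ½ ℚ.* ε           ≡⟨ ℚ.+-assoc (seq z n) _ _ ⟩
    seq z n ℚ.+ (½ ℚ.* ε ℚ.+ ½ ℚ.* ε)         ≡⟨ ≡.cong (seq z n ℚ.+_) (½*ε+½*ε ε) ⟩
    seq z n ℚ.+ ε                             ∎

+ʳ-mono : ∀ x y u v → x ≤ʳ y → u ≤ʳ v → x +ʳ u ≤ʳ y +ʳ v
+ʳ-mono x y u v x≤y u≤v ε ε>0 =
  Eventually-map add (Eventually-× (x≤y _ (0<½*ε ε>0)) (u≤v _ (0<½*ε ε>0)))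
  where
  open ℚ.≤-Reasoning
  open +-*-Solver
  add : ∀ n → seq x n ℚ.≤ seq y n ℚ.+ ½ ℚ.* ε × seq u n ℚ.≤ seq v n ℚ.+ ½ ℚ.* ε →
        seq x n ℚ.+ seq u n ℚ.≤ seq y n ℚ.+ seq v n ℚ.+ ε
  add n (x≤ , u≤) = begin
    seq x n ℚ.+ seq u n                                         ≤⟨ ℚ.+-mono-≤ x≤ u≤ ⟩
    (seq y n ℚ.+ ½ ℚ.* ε) ℚ.+ (seq v n ℚ.+ ½ ℚ.* ε)             ≡⟨ solve 3 (λ a b c → (a :+ c) :+ (b :+ c) := (a :+ b) :+ (c :+ c)) ≡.refl (seq y n) (seq v n) (½ ℚ.* ε) ⟩
    seq y n ℚ.+ seq v n ℚ.+ (½ ℚ.* ε ℚ.+ ½ ℚ.* ε)               ≡⟨ ≡.cong (seq y n ℚ.+ seq v n ℚ.+_) (½*ε+½*ε ε) ⟩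
    seq y n ℚ.+ seq v n ℚ.+ ε                                   ∎

≈ʳ-isEquivalence : IsEquivalence _≈ʳ_
≈ʳ-isEquivalence = record
  { refl  = λ {x} → ≈ʳ-pointwise x x λ _ → ≡.refl
  ; sym   = λ {x} {y} → ≈ʳ-sym x y
  ; trans = λ {x} {y} {z} → ≈ʳ-trans x y z
  }

ℝ-+-commutativeMonoid : CommutativeMonoid 0ℓ 0ℓ
ℝ-+-commutativeMonoid = record
  { Carrier = ℝ ; _≈_ = _≈ʳ_ ; _∙_ = _+ʳ_ ; ε = fromℚ 0ℚ
  ; isCommutativeMonoid = record
    { isMonoid = record
      { isSemigroup = record
        { isMagma = record
          { isEquivalence = ≈ʳ-isEquivalence
          ; ∙-cong = λ {x} {x′} {y} {y′} → +ʳ-cong x x′ y y′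
          }
        ; assoc = λ x y z → ≈ʳ-pointwise ((x +ʳ y) +ʳ z) (x +ʳ (y +ʳ z)) λ n → ℚ.+-assoc (seq x n) (seq y n) (seq z n)
        }
      ; identity = (λ x → ≈ʳ-pointwise (fromℚ 0ℚ +ʳ x) x λ n → ℚ.+-identityˡ (seq x n))
                 , (λ x → ≈ʳ-pointwise (x +ʳ fromℚ 0ℚ) x λ n → ℚ.+-identityʳ (seq x n))
      }
    ; comm = λ x y → ≈ʳ-pointwise (x +ʳ y) (y +ʳ x) λ n → ℚ.+-comm (seq x n) (seq y n)
    }
  }

ℝ-orderedMonoid : OrderedMonoid
ℝ-orderedMonoid = record
  { commutativeMonoid = ℝ-+-commutativeMonoid
  ; _≲_ = _≤ʳ_
  ; isPreorder = record
    { isEquivalence = ≈ʳ-isEquivalence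
    ; reflexive = λ {x} {y} → ≤ʳ-reflexive x y
    ; trans = λ {x} {y} {z} → ≤ʳ-trans x y z
    }
  ; +-mono = λ {x} {y} {u} {v} → +ʳ-mono x y u v
  }

-- The commutative ring of complex numbers

ℂ-pointwise : ∀ z w → (∀ n → seq (re z) n ≡ seq (re w) n) → (∀ n → seq (im z) n ≡ seq (im w) n) →
              z ℂ-Ring.≈ w
ℂ-pointwise z w re≗ im≗ = ≈ʳ-pointwise (re z) (re w) re≗ , ≈ʳ-pointwise (im z) (im w) im≗

module _ where
  open +-*-Solver

  private
    infixl 7 _⊛_
    infixl 6 _⊞_
    -- Complex arithmetic on pairs of solver polynomials, which turns each ring law into two
    -- rational polynomial identities at every index.
    _⊛_ _⊞_ : ∀ {k} → Polynomial k × Polynomial k → Polynomial k × Polynomial k →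
              Polynomial k × Polynomial k
    (a , b) ⊛ (c , d) = a :* c :+ :- (b :* d) , a :* d :+ b :* c
    (a , b) ⊞ (c , d) = a :+ c , b :+ d

  ℂ-*-assoc : ∀ x y z → (x ℂ-Ring.* y) ℂ-Ring.* z ℂ-Ring.≈ x ℂ-Ring.* (y ℂ-Ring.* z)
  ℂ-*-assoc x y z = ℂ-pointwise ((x ℂ-Ring.* y) ℂ-Ring.* z) (x ℂ-Ring.* (y ℂ-Ring.* z))
    (λ n → solve 6 (λ a b c d e f → proj₁ ((a , b) ⊛ (c , d) ⊛ (e , f)) := proj₁ ((a , b) ⊛ ((c , d) ⊛ (e , f))))
             ≡.refl (seq (re x) n) (seq (im x) n) (seq (re y) n) (seq (im y) n) (seq (re z) n) (seq (im z) n))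
    (λ n → solve 6 (λ a b c d e f → proj₂ ((a , b) ⊛ (c , d) ⊛ (e , f)) := proj₂ ((a , b) ⊛ ((c , d) ⊛ (e , f))))
             ≡.refl (seq (re x) n) (seq (im x) n) (seq (re y) n) (seq (im y) n) (seq (re z) n) (seq (im z) n))

  ℂ-*-comm : ∀ x y → x ℂ-Ring.* y ℂ-Ring.≈ y ℂ-Ring.* x
  ℂ-*-comm x y = ℂ-pointwise (x ℂ-Ring.* y) (y ℂ-Ring.* x)
    (λ n → solve 4 (λ a b c d → proj₁ ((a , b) ⊛ (c , d)) := proj₁ ((c , d) ⊛ (a , b)))
             ≡.refl (seq (re x) n) (seq (im x) n) (seq (re y) n) (seq (im y) n))
    (λ n → solve 4 (λ a b c d → proj₂ ((a , b) ⊛ (c , d)) := proj₂ ((c , d) ⊛ (a , b)))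
             ≡.refl (seq (re x) n) (seq (im x) n) (seq (re y) n) (seq (im y) n))

  ℂ-*-identityˡ : ∀ x → ℂ-Ring.1# ℂ-Ring.* x ℂ-Ring.≈ x
  ℂ-*-identityˡ x = ℂ-pointwise (ℂ-Ring.1# ℂ-Ring.* x) x
    (λ n → solve 2 (λ a b → proj₁ ((con 1ℚ , con 0ℚ) ⊛ (a , b)) := a) ≡.refl (seq (re x) n) (seq (im x) n))
    (λ n → solve 2 (λ a b → proj₂ ((con 1ℚ , con 0ℚ) ⊛ (a , b)) := b) ≡.refl (seq (re x) n) (seq (im x) n))

  ℂ-distribˡ : ∀ x y z → x ℂ-Ring.* (y ℂ-Ring.+ z) ℂ-Ring.≈ x ℂ-Ring.* y ℂ-Ring.+ x ℂ-Ring.* z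
  ℂ-distribˡ x y z = ℂ-pointwise (x ℂ-Ring.* (y ℂ-Ring.+ z)) (x ℂ-Ring.* y ℂ-Ring.+ x ℂ-Ring.* z)
    (λ n → solve 6 (λ a b c d e f → proj₁ ((a , b) ⊛ ((c , d) ⊞ (e , f))) :=
                                    proj₁ ((a , b) ⊛ (c , d) ⊞ (a , b) ⊛ (e , f)))
             ≡.refl (seq (re x) n) (seq (im x) n) (seq (re y) n) (seq (im y) n) (seq (re z) n) (seq (im z) n))
    (λ n → solve 6 (λ a b c d e f → proj₂ ((a , b) ⊛ ((c , d) ⊞ (e , f))) :=
                                    proj₂ ((a , b) ⊛ (c , d) ⊞ (a , b) ⊛ (e , f)))
             ≡.refl (seq (re x) n) (seq (im x) n) (seq (re y) n) (seq (im y) n) (seq (re z) n) (seq (im z) n))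

  ℂ-distribʳ : ∀ x y z → (y ℂ-Ring.+ z) ℂ-Ring.* x ℂ-Ring.≈ y ℂ-Ring.* x ℂ-Ring.+ z ℂ-Ring.* x
  ℂ-distribʳ x y z = ℂ-pointwise ((y ℂ-Ring.+ z) ℂ-Ring.* x) (y ℂ-Ring.* x ℂ-Ring.+ z ℂ-Ring.* x)
    (λ n → solve 6 (λ a b c d e f → proj₁ (((c , d) ⊞ (e , f)) ⊛ (a , b)) :=
                                    proj₁ ((c , d) ⊛ (a , b) ⊞ (e , f) ⊛ (a , b)))
             ≡.refl (seq (re x) n) (seq (im x) n) (seq (re y) n) (seq (im y) n) (seq (re z) n) (seq (im z) n))
    (λ n → solve 6 (λ a b c d e f → proj₂ (((c , d) ⊞ (e , f)) ⊛ (a , b)) :=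
                                    proj₂ ((c , d) ⊛ (a , b) ⊞ (e , f) ⊛ (a , b)))
             ≡.refl (seq (re x) n) (seq (im x) n) (seq (re y) n) (seq (im y) n) (seq (re z) n) (seq (im z) n))

ℂ-*-cong : ∀ x x′ y y′ → x ℂ-Ring.≈ x′ → y ℂ-Ring.≈ y′ → x ℂ-Ring.* y ℂ-Ring.≈ x′ ℂ-Ring.* y′
ℂ-*-cong x x′ y y′ (re-x≈ , im-x≈) (re-y≈ , im-y≈) =
    +ʳ-cong (re x *ʳ re y) (re x′ *ʳ re y′) (-ʳ (im x *ʳ im y)) (-ʳ (im x′ *ʳ im y′))
      (*ʳ-cong (re x) (re x′) (re y) (re y′) re-x≈ re-y≈)
      (-ʳ-cong (im x *ʳ im y) (im x′ *ʳ im y′) (*ʳ-cong (im x) (im x′) (im y) (im y′) im-x≈ im-y≈))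
  , +ʳ-cong (re x *ʳ im y) (re x′ *ʳ im y′) (im x *ʳ re y) (im x′ *ʳ re y′)
      (*ʳ-cong (re x) (re x′) (im y) (im y′) re-x≈ im-y≈)
      (*ʳ-cong (im x) (im x′) (re y) (re y′) im-x≈ re-y≈)

ℂ-trans : ∀ x y z → x ℂ-Ring.≈ y → y ℂ-Ring.≈ z → x ℂ-Ring.≈ z
ℂ-trans x y z (p , q) (p′ , q′) =
  ≈ʳ-trans (re x) (re y) (re z) p p′ , ≈ʳ-trans (im x) (im y) (im z) q q′

ℂ-isEquivalence : IsEquivalence ℂ-Ring._≈_
ℂ-isEquivalence = record
  { refl  = λ {z} → ℂ-pointwise z z (λ _ → ≡.refl) (λ _ → ≡.refl)
  ; sym   = λ {z} {w} (p , q) → ≈ʳ-sym (re z) (re w) p , ≈ʳ-sym (im z) (im w) q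
  ; trans = λ {z} {w} {v} → ℂ-trans z w v
  }

ℂ-commutativeRing : CommutativeRing 0ℓ 0ℓ
ℂ-commutativeRing = record
  { Carrier = ℂ ; _≈_ = ℂ-Ring._≈_ ; _+_ = ℂ-Ring._+_ ; _*_ = ℂ-Ring._*_
  ; -_ = ℂ-Ring.-_ ; 0# = ℂ-Ring.0# ; 1# = ℂ-Ring.1#
  ; isCommutativeRing = record
    { isRing = record
      { +-isAbelianGroup = record
        { isGroup = record
          { isMonoid = record
            { isSemigroup = record
              { isMagma = record
                { isEquivalence = ℂ-isEquivalence
                ; ∙-cong = λ {x} {x′} {y} {y′} (p , q) (p′ , q′) →
                    +ʳ-cong (re x) (re x′) (re y) (re y′) p p′ ,
                    +ʳ-cong (im x) (im x′) (im y) (im y′) q q′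
                }
              ; assoc = λ x y z → ℂ-pointwise ((x ℂ-Ring.+ y) ℂ-Ring.+ z) (x ℂ-Ring.+ (y ℂ-Ring.+ z))
                  (λ n → ℚ.+-assoc (seq (re x) n) (seq (re y) n) (seq (re z) n))
                  (λ n → ℚ.+-assoc (seq (im x) n) (seq (im y) n) (seq (im z) n))
              }
            ; identity =
                (λ x → ℂ-pointwise (ℂ-Ring.0# ℂ-Ring.+ x) x (λ n → ℚ.+-identityˡ (seq (re x) n)) (λ n → ℚ.+-identityˡ (seq (im x) n)))
              , (λ x → ℂ-pointwise (x ℂ-Ring.+ ℂ-Ring.0#) x (λ n → ℚ.+-identityʳ (seq (re x) n)) (λ n → ℚ.+-identityʳ (seq (im x) n)))
            }
          ; inverse =
              (λ x → ℂ-pointwise ((ℂ-Ring.- x) ℂ-Ring.+ x) ℂ-Ring.0# (λ n → ℚ.+-inverseˡ (seq (re x) n)) (λ n → ℚ.+-inverseˡ (seq (im x) n)))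
            , (λ x → ℂ-pointwise (x ℂ-Ring.+ (ℂ-Ring.- x)) ℂ-Ring.0# (λ n → ℚ.+-inverseʳ (seq (re x) n)) (λ n → ℚ.+-inverseʳ (seq (im x) n)))
          ; ⁻¹-cong = λ {x} {y} (p , q) → -ʳ-cong (re x) (re y) p , -ʳ-cong (im x) (im y) q
          }
        ; comm = λ x y → ℂ-pointwise (x ℂ-Ring.+ y) (y ℂ-Ring.+ x)
            (λ n → ℚ.+-comm (seq (re x) n) (seq (re y) n)) (λ n → ℚ.+-comm (seq (im x) n) (seq (im y) n))
        }
      ; *-cong = λ {x} {x′} {y} {y′} → ℂ-*-cong x x′ y y′
      ; *-assoc = ℂ-*-assoc
      ; *-identity = ℂ-*-identityˡ , λ x → ℂ-trans (x ℂ-Ring.* ℂ-Ring.1#) (ℂ-Ring.1# ℂ-Ring.* x) x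
          (ℂ-*-comm x ℂ-Ring.1#) (ℂ-*-identityˡ x)
      ; distrib = ℂ-distribˡ , ℂ-distribʳ
      }
    ; *-comm = ℂ-*-comm
    }
  }

-- Natural multiples of reals and Young's inequality

open OrderedSums ℝ-orderedMonoid using (_⊠_; ⊠-mono)

κ : ℕ → ℚ
κ k = k ×ℚ 1ℚ

seq-⊠ : ∀ k x n → seq (k ⊠ x) n ≡ κ k ℚ.* seq x n
seq-⊠ zero    x n = ≡.sym (ℚ.*-zeroˡ (seq x n))
seq-⊠ (suc k) x n = begin
  seq x n ℚ.+ seq (k ⊠ x) n           ≡⟨ ≡.cong (seq x n ℚ.+_) (seq-⊠ k x n) ⟩
  seq x n ℚ.+ κ k ℚ.* seq x n         ≡⟨ solve 2 (λ a c → a :+ c :* a := (con 1ℚ :+ c) :* a) ≡.refl (seq x n) (κ k) ⟩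
  (1ℚ ℚ.+ κ k) ℚ.* seq x n            ∎
  where
  open ≡.≡-Reasoning
  open +-*-Solver

0≤κ : ∀ k → 0ℚ ℚ.≤ κ k
0≤κ zero    = ℚ.≤-refl
0≤κ (suc k) = ℚ.+-mono-≤ (ℚ.<⇒≤ 0<1ℚ) (0≤κ k)

-- `_≤ʳ_` yields rational inequalities only up to a positive error. Distinct naturals differ by at
-- least 1, so an error of ½ is harmless.
κ-reflects-≤ : ∀ a b → κ a ℚ.≤ κ b ℚ.+ ½ → a ≤ b
κ-reflects-≤ zero    b       _ = ℕ.z≤n
κ-reflects-≤ (suc a) zero    p = contradiction
  (ℚ.≤-trans (p≤p+q 1ℚ (0≤κ a)) p) (from-no (1ℚ ℚ.≤? 0ℚ ℚ.+ ½))
κ-reflects-≤ (suc a) (suc b) p = ℕ.s≤s (κ-reflects-≤ a b (begin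
  κ a                               ≡⟨ solve 1 (λ a → a := con (ℚ.- 1ℚ) :+ (con 1ℚ :+ a)) ≡.refl (κ a) ⟩
  ℚ.- 1ℚ ℚ.+ (1ℚ ℚ.+ κ a)           ≤⟨ ℚ.+-monoʳ-≤ (ℚ.- 1ℚ) p ⟩
  ℚ.- 1ℚ ℚ.+ (1ℚ ℚ.+ κ b ℚ.+ ½)     ≡⟨ solve 1 (λ b → con (ℚ.- 1ℚ) :+ (con 1ℚ :+ b :+ con ½) := b :+ con ½) ≡.refl (κ b) ⟩
  κ b ℚ.+ ½                         ∎))
  where
  open ℚ.≤-Reasoning
  open +-*-Solver

⊠-reflects-≤ : ∀ a b → a ⊠ fromℚ 1ℚ ≤ʳ b ⊠ fromℚ 1ℚ → a ≤ b
⊠-reflects-≤ a b a≤b with a≤b ½ (from-yes (0ℚ ℚ.<? ½))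
... | N , p = κ-reflects-≤ a b (≡.subst₂ (λ x y → x ℚ.≤ y ℚ.+ ½) (κ≡ a) (κ≡ b) (p N ℕ.≤-refl))
  where
  κ≡ : ∀ k → seq (k ⊠ fromℚ 1ℚ) N ≡ κ k
  κ≡ k = ≡.trans (seq-⊠ k (fromℚ 1ℚ) N) (ℚ.*-identityʳ (κ k))

κ-2pq : ∀ p q → κ (2 * (p * q)) ≡ κ 2 ℚ.* (κ p ℚ.* κ q)
κ-2pq p q = ≡.trans (×1-homo-* 2 (p * q)) (≡.cong (κ 2 ℚ.*_) (×1-homo-* p q))

module _ where
  open +-*-Solver

  private
    Re⟪_,_⟫ : ℂ → ℂ → ℝ
    Re⟪ a , b ⟫ = re (conj a ℂ-Ring.* b)

    Re⟪⟫ : ∀ {k} → Polynomial k → Polynomial k → Polynomial k → Polynomial k → Polynomial k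
    Re⟪⟫ a b c d = a :* c :+ :- (:- b :* d)

  ⟪⟫-nonnegʳ : ∀ a → fromℚ 0ℚ ≤ʳ Re⟪ a , a ⟫
  ⟪⟫-nonnegʳ a = ≤ʳ-pointwise (fromℚ 0ℚ) Re⟪ a , a ⟫ λ n →
    ≡.subst (0ℚ ℚ.≤_)
      (solve 2 (λ a b → a :* a :+ b :* b := Re⟪⟫ a b a b) ≡.refl (seq (re a) n) (seq (im a) n))
      (ℚ.+-mono-≤ (0≤p*p (seq (re a) n)) (0≤p*p (seq (im a) n)))

  module _ (p q : ℕ) (a b : ℂ) where

    private
      lhs rhs : ℝ
      lhs = (2 * (p * q)) ⊠ Re⟪ a , b ⟫
      rhs = (p * p) ⊠ Re⟪ a , a ⟫ +ʳ (q * q) ⊠ Re⟪ b , b ⟫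

      seq-lhs : ∀ n → seq lhs n ≡ κ 2 ℚ.* (κ p ℚ.* κ q) ℚ.* seq Re⟪ a , b ⟫ n
      seq-lhs n = ≡.trans (seq-⊠ (2 * (p * q)) Re⟪ a , b ⟫ n) (≡.cong (ℚ._* _) (κ-2pq p q))

      seq-rhs : ∀ n → seq rhs n ≡ κ p ℚ.* κ p ℚ.* seq Re⟪ a , a ⟫ n ℚ.+ κ q ℚ.* κ q ℚ.* seq Re⟪ b , b ⟫ n
      seq-rhs n = ≡.cong₂ ℚ._+_
        (≡.trans (seq-⊠ (p * p) Re⟪ a , a ⟫ n) (≡.cong (ℚ._* _) (×1-homo-* p p)))
        (≡.trans (seq-⊠ (q * q) Re⟪ b , b ⟫ n) (≡.cong (ℚ._* _) (×1-homo-* q q)))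

    -- At every index the right side exceeds the left by |pa - qb|², split into the squares of its
    -- real and imaginary parts. In `young⁻ʳ` the whole right side is |pa + qb|².
    young⁺ʳ : lhs ≤ʳ rhs
    young⁺ʳ = ≤ʳ-pointwise lhs rhs λ n → ≡.subst₂ ℚ._≤_ (≡.sym (seq-lhs n))
      (≡.trans
        (solve 6 (λ P Q a b c d →
          con (κ 2) :* (P :* Q) :* Re⟪⟫ a b c d :+
            ((P :* a :- Q :* c) :* (P :* a :- Q :* c) :+ (P :* b :- Q :* d) :* (P :* b :- Q :* d)) :=
          P :* P :* Re⟪⟫ a b a b :+ Q :* Q :* Re⟪⟫ c d c d) ≡.refl
          (κ p) (κ q) (seq (re a) n) (seq (im a) n) (seq (re b) n) (seq (im b) n))
        (≡.sym (seq-rhs n)))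
      (p≤p+q _ (ℚ.+-mono-≤ (0≤p*p (κ p ℚ.* seq (re a) n ℚ.- κ q ℚ.* seq (re b) n))
                           (0≤p*p (κ p ℚ.* seq (im a) n ℚ.- κ q ℚ.* seq (im b) n))))

    young⁻ʳ : fromℚ 0ℚ ≤ʳ lhs +ʳ rhs
    young⁻ʳ = ≤ʳ-pointwise (fromℚ 0ℚ) (lhs +ʳ rhs) λ n → ≡.subst (0ℚ ℚ.≤_)
      (≡.trans
        (solve 6 (λ P Q a b c d →
          (P :* a :+ Q :* c) :* (P :* a :+ Q :* c) :+ (P :* b :+ Q :* d) :* (P :* b :+ Q :* d) :=
          con (κ 2) :* (P :* Q) :* Re⟪⟫ a b c d :+
            (P :* P :* Re⟪⟫ a b a b :+ Q :* Q :* Re⟪⟫ c d c d)) ≡.refl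
          (κ p) (κ q) (seq (re a) n) (seq (im a) n) (seq (re b) n) (seq (im b) n))
        (≡.sym (≡.cong₂ ℚ._+_ (seq-lhs n) (seq-rhs n))))
      (ℚ.+-mono-≤ (0≤p*p (κ p ℚ.* seq (re a) n ℚ.+ κ q ℚ.* seq (re b) n))
                  (0≤p*p (κ p ℚ.* seq (im a) n ℚ.+ κ q ℚ.* seq (im b) n)))

  conj-* : ∀ z w → conj (z ℂ-Ring.* w) ℂ-Ring.≈ conj z ℂ-Ring.* conj w
  conj-* z w = ℂ-pointwise (conj (z ℂ-Ring.* w)) (conj z ℂ-Ring.* conj w)
    (λ n → solve 4 (λ a b c d → a :* c :+ :- (b :* d) := a :* c :+ :- (:- b :* :- d)) ≡.refl
             (seq (re z) n) (seq (im z) n) (seq (re w) n) (seq (im w) n))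
    (λ n → solve 4 (λ a b c d → :- (a :* d :+ b :* c) := a :* :- d :+ :- b :* c) ≡.refl
             (seq (re z) n) (seq (im z) n) (seq (re w) n) (seq (im w) n))

  ∣∣²≈⟪⟫ : ∀ z → ∣ z ∣² ≈ʳ Re⟪ z , z ⟫
  ∣∣²≈⟪⟫ z = ≈ʳ-pointwise ∣ z ∣² Re⟪ z , z ⟫ λ n →
    solve 2 (λ a b → a :* a :+ b :* b := Re⟪⟫ a b a b) ≡.refl (seq (re z) n) (seq (im z) n)

ℂ-amplitudes : Amplitudes
ℂ-amplitudes = record
  { reals     = ℝ-orderedMonoid
  ; ring      = ℂ-commutativeRing
  ; star      = conj
  ; star-cong = λ {a} {b} (p , q) → p , -ʳ-cong (im a) (im b) q
  ; star-0    = ℂ-pointwise (conj ℂ-Ring.0#) ℂ-Ring.0# (λ _ → ≡.refl) (λ _ → ≡.refl)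
  ; star-1    = ℂ-pointwise (conj ℂ-Ring.1#) ℂ-Ring.1# (λ _ → ≡.refl) (λ _ → ≡.refl)
  ; star-+    = λ a b → ℂ-pointwise (conj (a ℂ-Ring.+ b)) (conj a ℂ-Ring.+ conj b) (λ _ → ≡.refl)
      (λ n → ℚ.neg-distrib-+ (seq (im a) n) (seq (im b) n))
  ; star-*    = conj-*
  ; real      = re
  ; real-cong = proj₁
  ; real-0    = ≈ʳ-pointwise (fromℚ 0ℚ) (fromℚ 0ℚ) (λ _ → ≡.refl)
  ; real-+    = λ a b → ≈ʳ-pointwise (re a +ʳ re b) (re a +ʳ re b) (λ _ → ≡.refl)
  ; ⟪⟫-nonneg = ⟪⟫-nonnegʳ
  ; young⁺    = young⁺ʳ
  ; young⁻    = young⁻ʳ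
  }

-- Squares in strings

2*n≡n+n : ∀ n → 2 * n ≡ n ℕ.+ n
2*n≡n+n n = ≡.cong (n ℕ.+_) (ℕ.+-identityʳ n)

⌊n/2⌋+⌊n/2⌋≤n : ∀ n → ⌊ n /2⌋ ℕ.+ ⌊ n /2⌋ ≤ n
⌊n/2⌋+⌊n/2⌋≤n n = ℕ.≤-trans (ℕ.+-monoʳ-≤ ⌊ n /2⌋ (ℕ.⌊n/2⌋≤⌈n/2⌉ n)) (ℕ.≤-reflexive (ℕ.⌊n/2⌋+⌈n/2⌉≡n n))

n≤1+⌊n/2⌋+⌊n/2⌋ : ∀ n → n ≤ suc (⌊ n /2⌋ ℕ.+ ⌊ n /2⌋)
n≤1+⌊n/2⌋+⌊n/2⌋ zero          = ℕ.z≤n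
n≤1+⌊n/2⌋+⌊n/2⌋ (suc zero)    = ℕ.s≤s ℕ.z≤n
n≤1+⌊n/2⌋+⌊n/2⌋ (suc (suc n)) = ℕ.s≤s (ℕ.s≤s (ℕ.≤-trans (n≤1+⌊n/2⌋+⌊n/2⌋ n)
  (ℕ.≤-reflexive (≡.sym (ℕ.+-suc ⌊ n /2⌋ ⌊ n /2⌋)))))

n+n≤o⇒n≤⌊o/2⌋ : ∀ n {o} → n ℕ.+ n ≤ o → n ≤ ⌊ o /2⌋
n+n≤o⇒n≤⌊o/2⌋ zero    n+n≤o = ℕ.z≤n
n+n≤o⇒n≤⌊o/2⌋ (suc n) {suc (suc o)} (ℕ.s≤s n+1+n≤1+o) =
  ℕ.s≤s (n+n≤o⇒n≤⌊o/2⌋ n (ℕ.s≤s⁻¹ (≡.subst (_≤ suc o) (ℕ.+-suc n n) n+1+n≤1+o)))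
n+n≤o⇒n≤⌊o/2⌋ (suc n) {suc zero} (ℕ.s≤s n+1+n≤0) =
  contradiction (≡.subst (_≤ 0) (ℕ.+-suc n n) n+1+n≤0) λ ()

module _ {A : Set} where

  infix 9 _‼_
  -- A total lookup, so that positions computed by addition carry no bound proofs.
  _‼_ : List A → ℕ → Maybe A
  []       ‼ _     = nothing
  (x ∷ xs) ‼ zero  = just x
  (x ∷ xs) ‼ suc k = xs ‼ k

  take-‼ : ∀ {k m} (xs : List A) → k ℕ.< m → take m xs ‼ k ≡ xs ‼ k
  take-‼ {zero}  {suc m} []       _   = ≡.refl
  take-‼ {suc k} {suc m} []       _   = ≡.refl
  take-‼ {zero}  {suc m} (x ∷ xs) _   = ≡.refl
  take-‼ {suc k} {suc m} (x ∷ xs) k<m = take-‼ xs (ℕ.s<s⁻¹ k<m)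

  drop-‼ : ∀ p (xs : List A) k → drop p xs ‼ k ≡ xs ‼ (p ℕ.+ k)
  drop-‼ zero    xs       k = ≡.refl
  drop-‼ (suc p) []       k = ≡.refl
  drop-‼ (suc p) (x ∷ xs) k = drop-‼ p xs k

  toList-‼ : ∀ {n} (xs : Vec A n) i → toList xs ‼ Fin.toℕ i ≡ just (lookup xs i)
  toList-‼ (x ∷ xs) zero    = ≡.refl
  toList-‼ (x ∷ xs) (suc i) = toList-‼ xs i

  take-replicate : ∀ {k n} (x : A) → k ≤ n → take k (List.replicate n x) ≡ List.replicate k x
  take-replicate {zero}          x _   = ≡.refl
  take-replicate {suc k} {suc n} x k≤n = ≡.cong (x ∷_) (take-replicate x (ℕ.s≤s⁻¹ k≤n))

  take-drop-replicate : ∀ p {k n} (x : A) → p ℕ.+ k ≤ n →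
    take k (drop p (List.replicate n x)) ≡ List.replicate k x
  take-drop-replicate zero            x k≤n   = take-replicate x k≤n
  take-drop-replicate (suc p) {n = suc n} x p+k≤n = take-drop-replicate p x (ℕ.s≤s⁻¹ p+k≤n)

module _ {σ n : ℕ} where

  -- Here `p` is the 0-based start. Passing to single entries removes slices and truncated
  -- subtraction from the combinatorics.
  square-repeats : ∀ {s : Str σ n} {Δ} → HasSquare s Δ →
    ∃[ p ] (p ℕ.+ (Δ ℕ.+ Δ) ≤ n ×
      (∀ k → k ℕ.< Δ → toList s ‼ (p ℕ.+ k) ≡ toList s ‼ (p ℕ.+ Δ ℕ.+ k)))
  square-repeats {s} {Δ} (suc p , _ , p+2Δ≤n , halves) = p , p+Δ+Δ≤n , repeats
    where
    open ≡.≡-Reasoning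
    p+Δ+Δ≤n : p ℕ.+ (Δ ℕ.+ Δ) ≤ n
    p+Δ+Δ≤n = ℕ.s≤s⁻¹ (≡.subst₂ _≤_ (≡.cong (λ e → suc (p ℕ.+ e)) (2*n≡n+n Δ)) (ℕ.+-comm n 1) p+2Δ≤n)
    lengthˡ : suc p ℕ.+ Δ ∸ suc p ≡ Δ
    lengthˡ = ℕ.m+n∸m≡n (suc p) Δ
    lengthʳ : suc p ℕ.+ 2 * Δ ∸ (suc p ℕ.+ Δ) ≡ Δ
    lengthʳ = ≡.trans (ℕ.[m+n]∸[m+o]≡n∸o (suc p) (2 * Δ) Δ)
             (≡.trans (≡.cong (_∸ Δ) (2*n≡n+n Δ)) (ℕ.m+n∸m≡n Δ Δ))
    halves′ : take Δ (drop p (toList s)) ≡ take Δ (drop (p ℕ.+ Δ) (toList s))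
    halves′ = ≡.subst₂ (λ a b → take a (drop p (toList s)) ≡ take b (drop (p ℕ.+ Δ) (toList s)))
      lengthˡ lengthʳ halves
    repeats : ∀ k → k ℕ.< Δ → toList s ‼ (p ℕ.+ k) ≡ toList s ‼ (p ℕ.+ Δ ℕ.+ k)
    repeats k k<Δ = begin
      toList s ‼ (p ℕ.+ k)                   ≡⟨ drop-‼ p (toList s) k ⟨
      drop p (toList s) ‼ k                  ≡⟨ take-‼ (drop p (toList s)) k<Δ ⟨
      take Δ (drop p (toList s)) ‼ k         ≡⟨ ≡.cong (_‼ k) halves′ ⟩
      take Δ (drop (p ℕ.+ Δ) (toList s)) ‼ k ≡⟨ take-‼ (drop (p ℕ.+ Δ) (toList s)) k<Δ ⟩
      drop (p ℕ.+ Δ) (toList s) ‼ k          ≡⟨ drop-‼ (p ℕ.+ Δ) (toList s) k ⟩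
      toList s ‼ (p ℕ.+ Δ ℕ.+ k)             ∎

  square-shift≤⌊n/2⌋ : ∀ (s : Str σ n) Δ → HasSquare s Δ → Δ ≤ ⌊ n /2⌋
  square-shift≤⌊n/2⌋ s Δ sq with square-repeats {s} {Δ} sq
  ... | p , p+Δ+Δ≤n , _ = n+n≤o⇒n≤⌊o/2⌋ Δ (ℕ.≤-trans (ℕ.m≤n+m (Δ ℕ.+ Δ) p) p+Δ+Δ≤n)

  hasSquare? : ∀ (s : Str σ n) Δ → Dec (HasSquare s Δ)
  hasSquare? s Δ = map′
    (λ { (i , _ , sq) → i , sq })
    (λ { (i , 1≤i , i+2Δ≤n+1 , eq) →
         i , ℕ.s≤s (ℕ.≤-trans (ℕ.m≤m+n i (2 * Δ)) i+2Δ≤n+1) , 1≤i , i+2Δ≤n+1 , eq })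
    (ℕ.anyUpTo?
      (λ i → (1 ℕ.≤? i) ×-dec (i ℕ.+ 2 * Δ ℕ.≤? n ℕ.+ 1) ×-dec
             List.≡-dec Fin._≟_ (s [ i ⋯ i ℕ.+ Δ ⟩) (s [ i ℕ.+ Δ ⋯ i ℕ.+ 2 * Δ ⟩))
      (suc (n ℕ.+ 1)))

  longest-square-below : ∀ (s : Str σ n) b → (∀ Δ → HasSquare s Δ → Δ ≤ b) →
                         ∃[ Δ ] IsLongestSquareShift s Δ
  -- Shift 0 always occurs, with two empty halves at position 1; the bound `1 ≤ n + 1` holds even
  -- for the empty string.
  longest-square-below s zero    bound = 0 , (1 , ℕ.s≤s ℕ.z≤n , ℕ.m≤n+m 1 n , ≡.refl) , bound
  longest-square-below s (suc b) bound with hasSquare? s (suc b)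
  ... | yes sq = suc b , sq , bound
  ... | no ¬sq = longest-square-below s b λ Δ sq →
    ℕ.s≤s⁻¹ (ℕ.≤∧≢⇒< (bound Δ sq) λ { ≡.refl → ¬sq sq })

  longest-square : ∀ (s : Str σ n) → ∃[ Δ ] IsLongestSquareShift s Δ
  longest-square s = longest-square-below s ⌊ n /2⌋ (square-shift≤⌊n/2⌋ s)

  constant-longest-square : ∀ a → IsLongestSquareShift (Vec.replicate n a) ⌊ n /2⌋
  constant-longest-square a = (1 , ℕ.s≤s ℕ.z≤n , bound , halves) , square-shift≤⌊n/2⌋ (Vec.replicate n a)
    where
    h = ⌊ n /2⌋
    bound : suc (2 * h) ≤ n ℕ.+ 1
    bound = ≡.subst₂ _≤_ (≡.cong suc (≡.sym (2*n≡n+n h))) (ℕ.+-comm 1 n) (ℕ.s≤s (⌊n/2⌋+⌊n/2⌋≤n n))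
    halves : take h (toList (Vec.replicate n a)) ≡ take (2 * h ∸ h) (drop h (toList (Vec.replicate n a)))
    halves rewrite Vec.toList-replicate n a | 2*n≡n+n h | ℕ.m+n∸m≡n h h =
      ≡.trans (take-replicate a (ℕ.⌊n/2⌋≤n n))
              (≡.sym (take-drop-replicate h a (⌊n/2⌋+⌊n/2⌋≤n n)))

  isolated-not-repeated : ∀ {s : Str σ n} {a} j → lookup s j ≡ a → (∀ i → i ≢ j → lookup s i ≢ a) →
    ∀ {k} → k ℕ.< n → k ≢ Fin.toℕ j → toList s ‼ Fin.toℕ j ≢ toList s ‼ k
  isolated-not-repeated {s} j s[j]≡a s[i]≢a {k} k<n k≢j eq =
    s[i]≢a i (λ i≡j → k≢j (≡.trans (≡.sym toℕ-i) (≡.cong Fin.toℕ i≡j)))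
      (≡.trans (≡.sym (just-injective s[j]≡s[i])) s[j]≡a)
    where
    i = Fin.fromℕ< k<n
    toℕ-i : Fin.toℕ i ≡ k
    toℕ-i = Fin.toℕ-fromℕ< k<n
    s[j]≡s[i] : just (lookup s j) ≡ just (lookup s i)
    s[j]≡s[i] = ≡.trans (≡.sym (toList-‼ s j)) (≡.trans eq
      (≡.trans (≡.cong (toList s ‼_) (≡.sym toℕ-i)) (toList-‼ s i)))

  -- A square of shift ⌊n/2⌋ leaves out at most one position, necessarily the first or the last. An
  -- interior `j` therefore lies in one of the halves, and the corresponding position of the other
  -- half would repeat the letter `a`, which occurs only at `j`.
  isolated-no-square : ∀ {s : Str σ n} {a} j → lookup s j ≡ a → (∀ i → i ≢ j → lookup s i ≢ a) →
    1 ≤ Fin.toℕ j → suc (suc (Fin.toℕ j)) ≤ n → ¬ HasSquare s ⌊ n /2⌋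
  isolated-no-square {s} j s[j]≡a s[i]≢a 1≤j j+2≤n sq with square-repeats {s} {⌊ n /2⌋} sq
  ... | p , p+Δ+Δ≤n , repeats with Fin.toℕ j ℕ.<? p ℕ.+ ⌊ n /2⌋
  ...   | yes J<p+Δ =
    isolated-not-repeated {s} j s[j]≡a s[i]≢a {p ℕ.+ Δ ℕ.+ k} (ℕ.<-≤-trans (ℕ.+-monoʳ-< (p ℕ.+ Δ) k<Δ)
        (≡.subst (_≤ n) (≡.sym (ℕ.+-assoc p Δ Δ)) p+Δ+Δ≤n))
      (λ eq → ℕ.<-irrefl ≡.refl (ℕ.<-≤-trans J<p+Δ (≡.subst (p ℕ.+ Δ ≤_) eq (ℕ.m≤m+n (p ℕ.+ Δ) k))))
      (≡.trans (≡.cong (toList s ‼_) (≡.sym p+k≡J)) (repeats k k<Δ))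
    where
    Δ = ⌊ n /2⌋
    J = Fin.toℕ j
    k = J ∸ p
    -- From `p + 2Δ ≤ n ≤ 2Δ + 1` follows `p ≤ 1`, so excluding the first position suffices.
    p≤J : p ≤ J
    p≤J = ℕ.≤-trans (ℕ.+-cancelʳ-≤ (Δ ℕ.+ Δ) p 1 (ℕ.≤-trans p+Δ+Δ≤n (n≤1+⌊n/2⌋+⌊n/2⌋ n))) 1≤j
    p+k≡J : p ℕ.+ k ≡ J
    p+k≡J = ℕ.m+[n∸m]≡n p≤J
    k<Δ : k ℕ.< Δ
    k<Δ = ℕ.+-cancelˡ-< p k Δ (≡.subst (ℕ._< p ℕ.+ Δ) (≡.sym p+k≡J) J<p+Δ)
  ...   | no J≮p+Δ =
    isolated-not-repeated {s} j s[j]≡a s[i]≢a {p ℕ.+ k} (ℕ.<-≤-trans p+k<p+Δ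
        (ℕ.≤-trans (ℕ.+-monoʳ-≤ p (ℕ.m≤m+n Δ Δ)) p+Δ+Δ≤n))
      (λ eq → ℕ.<-irrefl eq (ℕ.<-≤-trans p+k<p+Δ p+Δ≤J))
      (≡.sym (≡.trans (repeats k k<Δ) (≡.cong (toList s ‼_) p+Δ+k≡J)))
    where
    Δ = ⌊ n /2⌋
    J = Fin.toℕ j
    k = J ∸ (p ℕ.+ Δ)
    p+Δ≤J : p ℕ.+ Δ ≤ J
    p+Δ≤J = ℕ.≮⇒≥ J≮p+Δ
    p+Δ+k≡J : p ℕ.+ Δ ℕ.+ k ≡ J
    p+Δ+k≡J = ℕ.m+[n∸m]≡n p+Δ≤J
    -- The last position is excluded: `J + 2 ≤ n ≤ 2Δ + 1`. Thus `j` stays inside the second half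
    -- even when `p = 0`.
    J<Δ+Δ : J ℕ.< Δ ℕ.+ Δ
    J<Δ+Δ = ℕ.s≤s⁻¹ (ℕ.≤-trans j+2≤n (n≤1+⌊n/2⌋+⌊n/2⌋ n))
    k<Δ : k ℕ.< Δ
    k<Δ = ℕ.+-cancelˡ-< (p ℕ.+ Δ) k Δ (≡.subst (ℕ._< p ℕ.+ Δ ℕ.+ Δ) (≡.sym p+Δ+k≡J)
      (ℕ.<-≤-trans J<Δ+Δ (ℕ.+-monoˡ-≤ Δ (ℕ.m≤n+m Δ p))))
    p+k<p+Δ : p ℕ.+ k ℕ.< p ℕ.+ Δ
    p+k<p+Δ = ℕ.+-monoʳ-< p k<Δ

-- The lower bound

funToFin-cong : ∀ {m n} {f g : Fin m → Fin n} → (∀ i → f i ≡ g i) → Fin.funToFin f ≡ Fin.funToFin g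
funToFin-cong {zero}  f≗g = ≡.refl
funToFin-cong {suc m} f≗g = ≡.cong₂ Fin.combine (f≗g zero) (funToFin-cong (f≗g ∘ suc))

xorBit-involutive : ∀ a b → xorBit (xorBit a b) b ≡ a
xorBit-involutive zero       zero       = ≡.refl
xorBit-involutive zero       (suc zero) = ≡.refl
xorBit-involutive (suc zero) zero       = ≡.refl
xorBit-involutive (suc zero) (suc zero) = ≡.refl

⊕-involutive : ∀ {w} (a b : Fin (2 ^ w)) → _⊕_ {w} (_⊕_ {w} a b) b ≡ a
⊕-involutive {w} a b = ≡.trans
  (funToFin-cong λ j → ≡.trans
    (≡.cong (λ c → xorBit c (bits b j)) (Fin.finToFun-funToFin {w} {2} (λ j → xorBit (bits a j) (bits b j)) j))
    (xorBit-involutive (bits a j) (bits b j)))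
  (Fin.funToFin-finToFin {w} {2} a)
  where
  bits : Fin (2 ^ w) → Fin w → Fin 2
  bits = Fin.finToFun {2} {w}

2≤3× : ∀ P p → fromℚ (+ 2 ℚ./ 3) ≤ʳ P → P ≈ʳ p → 2 ⊠ fromℚ 1ℚ ≤ʳ 3 ⊠ p
2≤3× P p ⅔≤P P≈p = ≤ʳ-trans (2 ⊠ fromℚ 1ℚ) (3 ⊠ fromℚ ⅔) (3 ⊠ p)
  (≤ʳ-pointwise (2 ⊠ fromℚ 1ℚ) (3 ⊠ fromℚ ⅔) λ _ → ℚ.≤-reflexive ≡.refl)
  (⊠-mono 3 {fromℚ ⅔} {p} (≤ʳ-trans (fromℚ ⅔) P p ⅔≤P (≤ʳ-reflexive P p P≈p)))
  where
  ⅔ : ℚ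
  ⅔ = + 2 ℚ./ 3

-- Query algorithms as instances of the hybrid argument

module _ {σ n w T : ℕ} (fits : σ ≤ 2 ^ w) (A : QueryAlgorithm n w T) where
  open QueryAlgorithm A
  open Hybrid ℂ-amplitudes n (2 ^ w) d using (Flips; module Run)
  open Measurement ℂ-amplitudes {n} {2 ^ w} {d} output using (prob)
  open InnerProduct ℂ-amplitudes n (2 ^ w) d using (Isometry; unit; St)

  queryFlips : Str σ n → Flips
  queryFlips s = record
    { flip       = λ i b → _⊕_ {w} b (Fin.inject≤ (lookup s i) fits)
    ; involutive = λ i b → ⊕-involutive {w} b (Fin.inject≤ (lookup s i) fits)
    }

  unitary-isometry : (U : Unitary n (2 ^ w) d) → Isometry (matrix U)
  unitary-isometry U = proj₁ (isUnitary U)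

  initial : St
  initial = matrix (Vector.head unitary) · ∣ start ⟩

  initial-normalized : InnerProduct.Re⟨_,_⟩ ℂ-amplitudes n (2 ^ w) d initial initial ≈ʳ unit
  initial-normalized = ≈ʳ-trans Re⟨ initial , initial ⟩ Re⟨ ∣ start ⟩ , ∣ start ⟩ ⟩ unit
    (Re⟨⟩-isometry {matrix (Vector.head unitary)} (unitary-isometry (Vector.head unitary)) ∣ start ⟩ ∣ start ⟩)
    (Re⟨⟩-basis start)
    where open InnerProduct ℂ-amplitudes n (2 ^ w) d using (Re⟨_,_⟩; Re⟨⟩-isometry; Re⟨⟩-basis)

  module _ (v : ℕ) (ψ : St) where

    private
      weight weight′ : Basis n (2 ^ w) d → ℝ
      weight  x = if ⌊ output x ℕ.≟ v ⌋ then ∣ ψ x ∣² else fromℚ 0ℚ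
      weight′ x = if ⌊ output x ℕ.≟ v ⌋ then re (conj (ψ x) ℂ-Ring.* ψ x) else fromℚ 0ℚ

      weight≈weight′ : ∀ x → weight x ≈ʳ weight′ x
      weight≈weight′ x with output x ℕ.≟ v
      ... | yes _ = ∣∣²≈⟪⟫ (ψ x)
      ... | no  _ = ≈ʳ-pointwise (fromℚ 0ℚ) (fromℚ 0ℚ) λ _ → ≡.refl

    ∑∣∣²≈prob : ∑ʳ weight ≈ʳ prob v ψ
    ∑∣∣²≈prob = BasisSums.∑-cong ℝ-+-commutativeMonoid n (2 ^ w) d {weight} {weight′} weight≈weight′

  finalRun : Str σ n → St
  finalRun s = Run.run matrix unitary-isometry (queryFlips s) initial (Vector.tail unitary)

  -- At the concrete complex numbers, the abstract query, matrix product and run unfold to the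
  -- oracle, operator action and final state of the model.
  finalState≡finalRun : ∀ s → finalState fits A s ≡ finalRun s
  finalState≡finalRun s = ≡.refl

  computes⇒likely : ∀ {Answer} → Computes fits A Answer → ∀ s v → Answer s v →
                    2 ⊠ unit ≤ʳ 3 ⊠ prob v (finalRun s)
  computes⇒likely computes s v answer = ≡.subst (λ ψ → 2 ⊠ unit ≤ʳ 3 ⊠ prob v ψ) (finalState≡finalRun s)
    (2≤3× (Pr[output≡_] fits A v s) (prob v (finalState fits A s))
      (computes s v answer) (∑∣∣²≈prob v (finalState fits A s)))

-- The hard inputs and the asymptotic bound

module _ {σ N w T : ℕ} (fits : suc (suc σ) ≤ 2 ^ w) (A : QueryAlgorithm (suc (suc N)) w T)
         (computes : Computes fits A IsLongestSquareShift) where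
  open QueryAlgorithm A
  open Search ℂ-amplitudes N (2 ^ w) d
  open InnerProduct ℂ-amplitudes (suc (suc N)) (2 ^ w) d using (unit)
  open Measurement ℂ-amplitudes {suc (suc N)} {2 ^ w} {d} output using (prob)

  private
    n : ℕ
    n = suc (suc N)

    s₀ : Str (suc (suc σ)) n
    s₀ = Vec.replicate n zero

    s₁ : Fin N → Str (suc (suc σ)) n
    s₁ j = s₀ [ marked j ]≔ suc zero

    s₁-unmarked : ∀ j i → i ≢ marked j → lookup (s₁ j) i ≡ lookup s₀ i
    s₁-unmarked j i i≢j = Vec.lookup∘update′ i≢j s₀ (suc zero)

    -- Equality would turn the square that attains the longest shift into one of shift ⌊n/2⌋, which
    -- the isolated letter forbids.
    answers-differ : ∀ j → proj₁ (longest-square (s₁ j)) ≢ ⌊ n /2⌋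
    answers-differ j Δ≡ = isolated-no-square {s = s₁ j} (marked j)
      (Vec.lookup∘update (marked j) s₀ (suc zero))
      (λ i i≢j s[i]≡1 → Fin.0≢1+n
        (≡.trans (≡.sym (≡.trans (s₁-unmarked j i i≢j) (Vec.lookup-replicate i zero))) s[i]≡1))
      (ℕ.s≤s ℕ.z≤n)
      (ℕ.s≤s (ℕ.s≤s (≡.subst (ℕ._< N) (≡.sym (Fin.toℕ-inject₁ j)) (Fin.toℕ<n j))))
      (≡.subst (HasSquare (s₁ j)) Δ≡ (proj₁ (proj₂ (longest-square (s₁ j)))))

    correct : ∀ j → 2 ⊠ unit ≤ʳ 3 ⊠ prob (proj₁ (longest-square (s₁ j))) (finalRun fits A (s₁ j))
    correct j = computes⇒likely fits A computes (s₁ j)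
      (proj₁ (longest-square (s₁ j))) (proj₂ (longest-square (s₁ j)))

    correct₀ : 2 ⊠ unit ≤ʳ 3 ⊠ prob ⌊ n /2⌋ (finalRun fits A s₀)
    correct₀ = computes⇒likely fits A computes s₀ ⌊ n /2⌋ (constant-longest-square zero)

    agree : ∀ j i → i ≢ marked j → ∀ b → _⊕_ {w} b (Fin.inject≤ (lookup (s₁ j) i) fits) ≡ _⊕_ {w} b (Fin.inject≤ (lookup s₀ i) fits)
    agree j i i≢j b = ≡.cong (λ a → _⊕_ {w} b (Fin.inject≤ a fits)) (s₁-unmarked j i i≢j)

  N≤[36T]²-queries : N ≤ (36 * T) * (36 * T)
  N≤[36T]²-queries = search-bound matrix (unitary-isometry fits A) output ⊠-reflects-≤
      (λ j → queryFlips fits A (s₁ j)) (queryFlips fits A s₀) agree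
      (Vector.tail unitary) (initial fits A) (initial-normalized fits A)
      (λ j → proj₁ (longest-square (s₁ j))) ⌊ n /2⌋ answers-differ correct correct₀

proposition5p2 : ∃[ k ] ∃[ n₀ ] (1 ≤ k ×
    (∀ n → n₀ ≤ n →
    ∀ σ w → 2 ≤ σ → (fits : σ ≤ 2 ^ w) →
    ∀ T (A : QueryAlgorithm n w T) →
    Computes fits A IsLongestSquareShift →
    √ n ≤ k * T))
proposition5p2 = 72 , 3 , ℕ.s≤s ℕ.z≤n , bound
  where
  bound : ∀ n → 3 ≤ n → ∀ σ w → 2 ≤ σ → (fits : σ ≤ 2 ^ w) →
    ∀ T (A : QueryAlgorithm n w T) → Computes fits A IsLongestSquareShift → √ n ≤ 72 * T
  -- The threshold 3 gives `N ≥ 1`, hence `n = N + 2 ≤ 3N`. This is relaxed to `4N` because 4 is a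
  -- perfect square, and the constant becomes 72 = 2·36.
  bound (suc (suc N)) (ℕ.s≤s (ℕ.s≤s 1≤N)) (suc (suc σ)) w (ℕ.s≤s (ℕ.s≤s _)) fits T A computes = begin
    2 ℕ.+ N                    ≤⟨ ℕ.+-monoˡ-≤ N (ℕ.*-monoʳ-≤ 2 1≤N) ⟩
    2 * N ℕ.+ N                ≤⟨ ℕ.m≤m+n _ N ⟩
    2 * N ℕ.+ N ℕ.+ N          ≡⟨ 4N N ⟩
    4 * N                      ≤⟨ ℕ.*-monoʳ-≤ 4 (N≤[36T]²-queries fits A computes) ⟩
    4 * (36 * T * (36 * T))    ≡⟨ square T ⟩
    72 * T * (72 * T * 1)      ∎
    where
    open ℕ.≤-Reasoning
    4N : ∀ N → 2 * N ℕ.+ N ℕ.+ N ≡ 4 * N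
    4N = solve-∀
    square : ∀ T → 4 * (36 * T * (36 * T)) ≡ 72 * T * (72 * T * 1)
    square = solve-∀
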